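{- Let $p\ge 2$ and $n\ge\max\{4,2p-1\}$. Let $F\subseteq E(K_n)$ be a set of $p$ edges, and assume that $K_n-F$ is connected. Let $F_0\subseteq E(K_n)$ be an edge set such that $H_{F_0}\cong P_3\cup(p-2)K_2$. If $H_F$ is not a matching, then $$Kf(K_n-F)\ge Kf(K_n-F_0),$$ and more explicitly $$Kf(K_n-F)\ge n-1+\frac{3}{n-3}+\frac{1}{n-1}+\frac{2(p-2)}{n-2}.$$ Equality holds if and only if $H_F\cong P_3\cup(p-2)K_2$.
   Context: $K_n$ is the complete graph on $n$ vertices and $K_n-F$ is obtained from it by deleting the edges in $F$ (keeping all vertices). The deletion graph of $F$ is $H_F=(V(F),F)$ with $V(F)=\bigcup_{e\in F}e$ (the set of endpoints of edges of $F$). $P_3$ is the path on $3$ vertices, and $P_3\cup(p-2)K_2$ is the disjoint union of $P_3$ and $p-2$ single edges. "$H_F$ is not a matching" means that some two distinct edges of $F$ share an endpoint, i.e. $H_F\not\cong pK_2$. For a connected graph $G$ with Laplacian $L(G)=D(G)-A(G)$, the effective resistance between distinct vertices is $R_G(x,y)=(e_x-e_y)^TL(G)^+(e_x-e_y)$ ($L(G)^+$ the Moore--Penrose inverse, $e_x$ the standard basis vector of vertex $x$), and the Kirchhoff index is $Kf(G)=\sum_{\{x,y\}}R_G(x,y)$, the sum over all unordered pairs of distinct vertices. -}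

module Defs where

open import Data.Bool.Base using (Bool; true; false; T; not; _∧_; _∨_; if_then_else_)
open import Data.Bool.Properties using (∨-comm; ∧-zeroʳ)
open import Data.Fin.Base using (Fin; zero; suc; toℕ)
open import Data.Fin.Properties using (_≟_; _<?_)
import Data.Integer.Base as ℤ
open import Data.Nat.Base as ℕ using (ℕ; zero; suc; _∸_; NonZero)
import Data.Nat.Properties as ℕₚ
open import Data.Product.Base using (Σ; ∃; _×_; _,_; proj₁; proj₂)
open import Data.Rational.Base as ℚ using (ℚ; 0ℚ; 1ℚ; _+_; _-_; _*_; -_; _/_)
import Data.Rational.Properties as ℚₚ
open import Data.Rational.Solver using (module +-*-Solver)
open import Data.Refinement.Base using (Refinement-syntax; value)
open import Data.Sum.Base using (_⊎_; inj₁; inj₂)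
open import Data.Vec.Functional using (Vector; tail)
open import Function.Bundles using (_↔_; Inverse)
open import Relation.Binary.Construct.Closure.ReflexiveTransitive using (Star)
open import Relation.Binary.PropositionalEquality
open import Relation.Nullary using (does; yes; no)
open import Relation.Nullary.Decidable using (dec-true)

open import Algebra.Bundles using (CommutativeRing)
open import Algebra.Properties.Semiring.Sum
  (CommutativeRing.semiring ℚₚ.+-*-commutativeRing)
open import Algebra.Properties.Monoid.Sum ℕₚ.+-0-monoid
  using () renaming (sum to sumℕ)

record SimpleGraph (V : Set) : Set where
  field
    adj        : V → V → Bool
    adj-sym    : ∀ u v → adj u v ≡ adj v u
    adj-irrefl : ∀ v → adj v v ≡ false

  Adj : V → V → Set
  Adj u v = T (adj u v)

open SimpleGraph public

Connected : ∀ {V} → SimpleGraph V → Set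
Connected G = ∀ u v → Star (Adj G) u v

infix 4 _≅_

record _≅_ {V W : Set} (G : SimpleGraph V) (H : SimpleGraph W) : Set where
  field
    vertices  : V ↔ W
    preserves : ∀ u v → adj G u v ≡ adj H (Inverse.to vertices u) (Inverse.to vertices v)

private
  ≟-sym : ∀ {n} (i j : Fin n) → does (i ≟ j) ≡ does (j ≟ i)
  ≟-sym zero    zero    = refl
  ≟-sym zero    (suc j) = refl
  ≟-sym (suc i) zero    = refl
  ≟-sym (suc i) (suc j) = ≟-sym i j

  ≟-refl : ∀ {n} (i : Fin n) → does (i ≟ i) ≡ true
  ≟-refl i = dec-true (i ≟ i) refl

K : ∀ n → SimpleGraph (Fin n)
K n = record
  { adj        = λ u v → not (does (u ≟ v))
  ; adj-sym    = λ u v → cong not (≟-sym u v)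
  ; adj-irrefl = λ v → cong not (≟-refl v)
  }

P : ∀ n → SimpleGraph (Fin n)
P n = record
  { adj        = λ u v → next u v ∨ next v u
  ; adj-sym    = λ u v → ∨-comm (next u v) (next v u)
  ; adj-irrefl = λ v → cong₂ _∨_ (irr (toℕ v)) (irr (toℕ v))
  }
  where
  next : Fin n → Fin n → Bool
  next u v = suc (toℕ u) ℕ.≡ᵇ toℕ v

  irr : ∀ k → (suc k ℕ.≡ᵇ k) ≡ false
  irr zero    = refl
  irr (suc k) = irr k

infixr 5 _⊍_

_⊍_ : ∀ {V W} → SimpleGraph V → SimpleGraph W → SimpleGraph (V ⊎ W)
G ⊍ H = record
  { adj = λ { (inj₁ u) (inj₁ v) → adj G u v
            ; (inj₁ _) (inj₂ _) → false
            ; (inj₂ _) (inj₁ _) → false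
            ; (inj₂ u) (inj₂ v) → adj H u v }
  ; adj-sym = λ { (inj₁ u) (inj₁ v) → adj-sym G u v
                ; (inj₁ _) (inj₂ _) → refl
                ; (inj₂ _) (inj₁ _) → refl
                ; (inj₂ u) (inj₂ v) → adj-sym H u v }
  ; adj-irrefl = λ { (inj₁ v) → adj-irrefl G v ; (inj₂ v) → adj-irrefl H v }
  }

copies : ∀ {V} m → SimpleGraph V → SimpleGraph (Fin m × V)
copies m G = record
  { adj        = λ { (i , u) (j , v) → does (i ≟ j) ∧ adj G u v }
  ; adj-sym    = λ { (i , u) (j , v) → cong₂ _∧_ (≟-sym i j) (adj-sym G u v) }
  ; adj-irrefl = λ { (i , v) → trans (cong (does (i ≟ i) ∧_) (adj-irrefl G v)) (∧-zeroʳ _) }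
  }

-- A subset of E(Kₙ) is a set of unordered pairs of distinct elements of
-- Fin n, which is the same data as a simple graph on Fin n.

EdgeSet : ℕ → Set
EdgeSet n = SimpleGraph (Fin n)

size : ∀ {n} → EdgeSet n → ℕ
size F = sumℕ λ u → sumℕ λ v → if does (u <? v) ∧ adj F u v then 1 else 0

infixl 6 _∖_

_∖_ : ∀ {n} → SimpleGraph (Fin n) → EdgeSet n → SimpleGraph (Fin n)
G ∖ F = record
  { adj        = λ u v → adj G u v ∧ not (adj F u v)
  ; adj-sym    = λ u v → cong₂ (λ a b → a ∧ not b) (adj-sym G u v) (adj-sym F u v)
  ; adj-irrefl = λ v → cong (_∧ not (adj F v v)) (adj-irrefl G v)
  }

-- The membership proof in a refinement type is irrelevant, so each
-- endpoint occurs exactly once.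

Endpoints : ∀ {n} → EdgeSet n → Set
Endpoints {n} F = [ v ∈ Fin n ∣ ∃ (λ w → Adj F v w) ]

deletionGraph : ∀ {n} (F : EdgeSet n) → SimpleGraph (Endpoints F)
deletionGraph F = record
  { adj        = λ u v → adj F (value u) (value v)
  ; adj-sym    = λ u v → adj-sym F (value u) (value v)
  ; adj-irrefl = λ v → adj-irrefl F (value v)
  }

-- Two distinct edges {u,v} and {u,w} share the endpoint u.

NotMatching : ∀ {n} → EdgeSet n → Set
NotMatching F = ∃ λ u → ∃ λ v → ∃ λ w → v ≢ w × Adj F u v × Adj F u w

Matrix : ℕ → ℕ → Set
Matrix m n = Fin m → Fin n → ℚ

infix  4 _≋_
infixl 7 _⊗_

_≋_ : ∀ {m n} → Matrix m n → Matrix m n → Set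
A ≋ B = ∀ i j → A i j ≡ B i j

_⊗_ : ∀ {m n k} → Matrix m n → Matrix n k → Matrix m k
(A ⊗ B) i j = ∑[ l < _ ] (A i l * B l j)

_ᵀ : ∀ {m n} → Matrix m n → Matrix n m
(A ᵀ) i j = A j i

record IsMoorePenrose {m n} (A : Matrix m n) (B : Matrix n m) : Set where
  field
    ABA≋A  : A ⊗ B ⊗ A ≋ A
    BAB≋B  : B ⊗ A ⊗ B ≋ B
    AB-sym : (A ⊗ B) ᵀ ≋ A ⊗ B
    BA-sym : (B ⊗ A) ᵀ ≋ B ⊗ A

-- Every rational matrix has a Moore–Penrose inverse, by Greville's recursion
-- on the columns.

private
  open ≡-Reasoning

  infix 8 _·_

  _·_ : ∀ {n} → Vector ℚ n → Vector ℚ n → ℚ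
  x · y = ∑[ i < _ ] (x i * y i)

  ∑-*ˡ : ∀ {n} x (f : Vector ℚ n) → ∑[ i < n ] (x * f i) ≡ x * sum f
  ∑-*ˡ x f = sym (*-distribˡ-sum x f)

  ∑-- : ∀ {n} (f g : Vector ℚ n) → ∑[ i < n ] (f i - g i) ≡ sum f - sum g
  ∑-- {zero}  f g = refl
  ∑-- {suc n} f g = begin
    (f zero - g zero) + sum (λ i → f (suc i) - g (suc i))
      ≡⟨ cong (λ v → (f zero - g zero) + v) (∑-- (tail f) (tail g)) ⟩
    (f zero - g zero) + (sum (tail f) - sum (tail g))
      ≡⟨ solve 4 (λ a b x y → (a :- b) :+ (x :- y) := (a :+ x) :- (b :+ y)) refl
           (f zero) (g zero) (sum (tail f)) (sum (tail g)) ⟩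
    sum f - sum g ∎
    where open +-*-Solver

  ·-comm : ∀ {n} (x y : Vector ℚ n) → x · y ≡ y · x
  ·-comm x y = sum-cong-≗ λ i → ℚₚ.*-comm (x i) (y i)

  ·-congˡ : ∀ {n} (x : Vector ℚ n) {y z : Vector ℚ n} → y ≗ z → x · y ≡ x · z
  ·-congˡ x eq = sum-cong-≗ λ i → cong (x i *_) (eq i)

  ·-congʳ : ∀ {n} {y z : Vector ℚ n} (x : Vector ℚ n) → y ≗ z → y · x ≡ z · x
  ·-congʳ x eq = sum-cong-≗ λ i → cong (_* x i) (eq i)

  ·-scaleˡ : ∀ {n} q (x y : Vector ℚ n) → (λ i → q * x i) · y ≡ q * (x · y)
  ·-scaleˡ q x y = trans (sum-cong-≗ λ i → ℚₚ.*-assoc q (x i) (y i)) (∑-*ˡ q (λ i → x i * y i))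

  ·-scaleʳ : ∀ {n} q (x y : Vector ℚ n) → x · (λ i → y i * q) ≡ x · y * q
  ·-scaleʳ q x y = trans (sum-cong-≗ λ i → sym (ℚₚ.*-assoc (x i) (y i) q))
                         (sym (*-distribʳ-sum q (λ i → x i * y i)))

  ·-minusˡ : ∀ {n} (x y z : Vector ℚ n) → (λ i → x i - y i) · z ≡ x · z - y · z
  ·-minusˡ x y z = trans (sum-cong-≗ λ i →
    solve 3 (λ a b c → (a :- b) :* c := a :* c :- b :* c) refl (x i) (y i) (z i))
    (∑-- (λ i → x i * z i) (λ i → y i * z i))
    where open +-*-Solver

  ·-minusʳ : ∀ {n} (x y z : Vector ℚ n) → x · (λ i → y i - z i) ≡ x · y - x · z
  ·-minusʳ x y z = trans (·-comm x _) (trans (·-minusˡ y z x) (cong₂ _-_ (·-comm y x) (·-comm z x)))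

  ·-plusˡ : ∀ {n} (x y z : Vector ℚ n) → (λ i → x i + y i) · z ≡ x · z + y · z
  ·-plusˡ x y z = trans (sum-cong-≗ λ i → ℚₚ.*-distribʳ-+ (z i) (x i) (y i))
                         (∑-distrib-+ (λ i → x i * z i) (λ i → y i * z i))

  ·-assoc : ∀ {m n} (x : Vector ℚ m) (B : Matrix m n) (y : Vector ℚ n) →
            (λ k → x · (λ l → B l k)) · y ≡ x · (λ l → B l · y)
  ·-assoc {m} {n} x B y = begin
    ∑[ k < n ] ((∑[ l < m ] (x l * B l k)) * y k)
      ≡⟨ sum-cong-≗ (λ k → *-distribʳ-sum (y k) (λ l → x l * B l k)) ⟩
    ∑[ k < n ] ∑[ l < m ] (x l * B l k * y k)
      ≡⟨ ∑-comm (λ k l → x l * B l k * y k) ⟩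
    ∑[ l < m ] ∑[ k < n ] (x l * B l k * y k)
      ≡⟨ sum-cong-≗ (λ l → trans (sum-cong-≗ λ k → ℚₚ.*-assoc (x l) (B l k) (y k))
                                 (∑-*ˡ (x l) (λ k → B l k * y k))) ⟩
    ∑[ l < m ] (x l * (B l · y)) ∎

  square-nonneg : ∀ q → 0ℚ ℚ.≤ q * q
  square-nonneg q with ℚₚ.≤-total 0ℚ q
  ... | inj₁ 0≤q = subst (ℚ._≤ q * q) (ℚₚ.*-zeroˡ q)
                     (ℚₚ.*-monoʳ-≤-nonNeg q {{ℚ.nonNegative 0≤q}} 0≤q)
  ... | inj₂ q≤0 = subst (ℚ._≤ q * q) (ℚₚ.*-zeroˡ q)
                     (ℚₚ.*-monoʳ-≤-nonPos q {{ℚ.nonPositive q≤0}} q≤0)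

  ·-nonneg : ∀ {n} (x : Vector ℚ n) → 0ℚ ℚ.≤ x · x
  ·-nonneg {zero}  x = ℚₚ.≤-refl
  ·-nonneg {suc n} x = ℚₚ.+-mono-≤ (square-nonneg (x zero)) (·-nonneg (tail x))

  +-zeroˡ⁻ : ∀ {p q} → 0ℚ ℚ.≤ p → 0ℚ ℚ.≤ q → p + q ≡ 0ℚ → p ≡ 0ℚ
  +-zeroˡ⁻ {p} {q} 0≤p 0≤q eq = ℚₚ.≤-antisym
    (subst₂ ℚ._≤_ (ℚₚ.+-identityʳ p) eq (ℚₚ.+-monoʳ-≤ p 0≤q)) 0≤p

  square-zero : ∀ q → q * q ≡ 0ℚ → q ≡ 0ℚ
  square-zero q eq with q ℚₚ.≟ 0ℚ
  ... | yes q≡0 = q≡0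
  ... | no  q≢0 = begin
    q                 ≡⟨ ℚₚ.*-identityʳ q ⟨
    q * 1ℚ            ≡⟨ cong (q *_) (ℚₚ.*-inverseʳ q) ⟨
    q * (q * ℚ.1/ q)  ≡⟨ ℚₚ.*-assoc q q (ℚ.1/ q) ⟨
    q * q * ℚ.1/ q    ≡⟨ cong (_* ℚ.1/ q) eq ⟩
    0ℚ * ℚ.1/ q       ≡⟨ ℚₚ.*-zeroˡ (ℚ.1/ q) ⟩
    0ℚ                ∎
    where instance _ = ℚ.≢-nonZero q≢0

  ·-zero : ∀ {n} (x : Vector ℚ n) → x · x ≡ 0ℚ → ∀ i → x i ≡ 0ℚ
  ·-zero {suc n} x eq zero    =
    square-zero (x zero) (+-zeroˡ⁻ (square-nonneg (x zero)) (·-nonneg (tail x)) eq)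
  ·-zero {suc n} x eq (suc i) =
    ·-zero (tail x) (+-zeroˡ⁻ (·-nonneg (tail x)) (square-nonneg (x zero))
                       (trans (ℚₚ.+-comm (tail x · tail x) (x zero * x zero)) eq)) i

  inverse : ∀ q → q ≢ 0ℚ → ∃ λ t → t * q ≡ 1ℚ
  inverse q q≢0 = ℚ.1/ q , ℚₚ.*-inverseˡ q
    where instance _ = ℚ.≢-nonZero q≢0

  module Greville {m n} (A : Matrix m (suc n)) (B : Matrix n m)
                  (B-mp : IsMoorePenrose (λ i j → A i (suc j)) B) where
    open IsMoorePenrose B-mp

    A′ : Matrix m n
    A′ i j = A i (suc j)

    a c : Vector ℚ m
    a i = A i zero

    d : Vector ℚ n
    d i = B i · a

    c i = a i - A′ i · d

    col : ∀ {p q} → Matrix p q → Fin q → Vector ℚ p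
    col M j i = M i j

    record Row : Set where
      field
        b : Vector ℚ m
      β : ℚ
      β = b · a
      e : Vector ℚ n
      e j = b · col A′ j
      field
        cb-sym : ∀ i k → c i * b k ≡ c k * b i
        ce     : ∀ i j → c i * e j ≡ 0ℚ
        cβ     : ∀ i → c i * β ≡ c i
        e≗     : ∀ j → e j ≡ d j - d j * β
        eB     : ∀ k → β * b k + (e · col B k - e · d * b k) ≡ b k

    A′d : ∀ i → A′ i · d ≡ (A′ ⊗ B) i · a
    A′d i = sym (·-assoc (A′ i) B a)

    BA′d : ∀ i → (B ⊗ A′) i · d ≡ d i
    BA′d i = begin
      (B ⊗ A′) i · d        ≡⟨ ·-assoc ((B ⊗ A′) i) B a ⟨
      (B ⊗ A′ ⊗ B) i · a    ≡⟨ ·-congʳ a (BAB≋B i) ⟩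
      d i                   ∎

    cA′ : ∀ j → c · col A′ j ≡ 0ℚ
    cA′ j = begin
      c · col A′ j
        ≡⟨ ·-minusˡ a (λ i → A′ i · d) (col A′ j) ⟩
      a · col A′ j - (λ i → A′ i · d) · col A′ j
        ≡⟨ cong (λ v → a · col A′ j - v) (begin
             (λ i → A′ i · d) · col A′ j
               ≡⟨ ·-congʳ (col A′ j) (λ i → trans (A′d i) (trans (·-comm _ a)
                    (·-congˡ a λ k → AB-sym k i))) ⟩
             (λ i → a · (λ k → (A′ ⊗ B) k i)) · col A′ j
               ≡⟨ ·-assoc a (A′ ⊗ B) (col A′ j) ⟩
             a · (λ k → (A′ ⊗ B ⊗ A′) k j)
               ≡⟨ ·-congˡ a (λ k → ABA≋A k j) ⟩
             a · col A′ j ∎) ⟩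
      a · col A′ j - a · col A′ j
        ≡⟨ ℚₚ.+-inverseʳ (a · col A′ j) ⟩
      0ℚ ∎

    row : Row
    row with c · c ℚₚ.≟ 0ℚ
    row | no cc≢0 = record
      { b = b ; cb-sym = λ i k → solve 3 (λ x y t → x :* (t :* y) := y :* (t :* x)) refl (c i) (c k) t
      ; ce = λ i j → trans (cong (c i *_) (e≡0 j)) (ℚₚ.*-zeroʳ (c i))
      ; cβ = λ i → trans (cong (c i *_) β≡1) (ℚₚ.*-identityʳ (c i))
      ; e≗ = λ j → trans (e≡0 j) (sym (trans (cong (λ z → d j - d j * z) β≡1)
                     (solve 1 (λ x → x :- x :* con 1ℚ := con 0ℚ) refl (d j))))
      ; eB = λ k → begin
          b · a * b k + (e · col B k - e · d * b k)
            ≡⟨ cong₂ (λ u v → u * b k + v) β≡1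
                 (cong₂ (λ u v → u - v * b k) (e·≡0 (col B k)) (e·≡0 d)) ⟩
          1ℚ * b k + (0ℚ - 0ℚ * b k)
            ≡⟨ solve 1 (λ x → con 1ℚ :* x :+ (con 0ℚ :- con 0ℚ :* x) := x) refl (b k) ⟩
          b k ∎
      }
      where
      open +-*-Solver
      t : ℚ
      t = proj₁ (inverse _ cc≢0)
      b : Vector ℚ m
      b k = t * c k
      e : Vector ℚ n
      e j = b · col A′ j
      e≡0 : ∀ j → e j ≡ 0ℚ
      e≡0 j = trans (·-scaleˡ t c (col A′ j)) (trans (cong (t *_) (cA′ j)) (ℚₚ.*-zeroʳ t))
      e·≡0 : ∀ x → e · x ≡ 0ℚ
      e·≡0 x = trans (sum-cong-≗ λ j → trans (cong (_* x j) (e≡0 j)) (ℚₚ.*-zeroˡ (x j)))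
                     (sum-replicate-zero n)
      c·A′d : c · (λ i → A′ i · d) ≡ 0ℚ
      c·A′d = begin
        c · (λ i → A′ i · d)          ≡⟨ ·-assoc c A′ d ⟨
        (λ j → c · col A′ j) · d      ≡⟨ sum-cong-≗ (λ j → trans (cong (_* d j) (cA′ j)) (ℚₚ.*-zeroˡ (d j))) ⟩
        ∑[ j < n ] 0ℚ                 ≡⟨ sum-replicate-zero n ⟩
        0ℚ                            ∎
      c·a : c · a ≡ c · c
      c·a = begin
        c · a                             ≡⟨ solve 1 (λ x → x := x :- con 0ℚ) refl (c · a) ⟩
        c · a - 0ℚ                        ≡⟨ cong (λ z → c · a - z) c·A′d ⟨
        c · a - c · (λ i → A′ i · d)      ≡⟨ ·-minusʳ c a (λ i → A′ i · d) ⟨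
        c · c                             ∎
      β≡1 : b · a ≡ 1ℚ
      β≡1 = trans (·-scaleˡ t c a) (trans (cong (t *_) c·a) (proj₂ (inverse _ cc≢0)))

    row | yes cc≡0 = record
      { b = b
      ; cb-sym = λ i k → trans (c* i (b k)) (sym (c* k (b i)))
      ; ce = λ i j → c* i (e j)
      ; cβ = λ i → trans (c* i (b · a)) (sym (c≡0 i))
      ; e≗ = λ j → begin
          e j                                    ≡⟨ e≡td j ⟩
          t * d j                                ≡⟨ solve 3 (λ t x δ → t :* x := (t :* (con 1ℚ :+ δ)) :* x :- x :* (t :* δ)) refl t (d j) δ ⟩
          (t * (1ℚ + δ)) * d j - d j * (t * δ)   ≡⟨ cong₂ (λ u v → u * d j - d j * v) t-inv (sym β≡tδ) ⟩
          1ℚ * d j - d j * (b · a)               ≡⟨ cong (_- d j * (b · a)) (ℚₚ.*-identityˡ (d j)) ⟩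
          d j - d j * (b · a)                    ∎
      ; eB = λ k → begin
          b · a * b k + (e · col B k - e · d * b k)
            ≡⟨ cong₂ (λ u v → u * b k + v) β≡tδ
                 (cong₂ (λ u v → u - v * b k)
                   (trans (·-congʳ (col B k) e≡td) (·-scaleˡ t d (col B k)))
                   (trans (·-congʳ d e≡td) (·-scaleˡ t d d))) ⟩
          t * δ * b k + (b k - t * δ * b k)
            ≡⟨ solve 2 (λ x y → x :* y :+ (y :- x :* y) := y) refl (t * δ) (b k) ⟩
          b k ∎
      }
      where
      open +-*-Solver
      c≡0 : ∀ i → c i ≡ 0ℚ
      c≡0 = ·-zero c cc≡0
      c* : ∀ i x → c i * x ≡ 0ℚ
      c* i x = trans (cong (_* x) (c≡0 i)) (ℚₚ.*-zeroˡ x)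
      δ : ℚ
      δ = d · d
      1+δ≢0 : 1ℚ + δ ≢ 0ℚ
      1+δ≢0 eq with +-zeroˡ⁻ (ℚₚ.nonNegative⁻¹ 1ℚ) (·-nonneg d) eq
      ... | ()
      t : ℚ
      t = proj₁ (inverse _ 1+δ≢0)
      t-inv : t * (1ℚ + δ) ≡ 1ℚ
      t-inv = proj₂ (inverse _ 1+δ≢0)
      b : Vector ℚ m
      b k = t * (d · col B k)
      e : Vector ℚ n
      e j = b · col A′ j
      β≡tδ : b · a ≡ t * δ
      β≡tδ = trans (·-scaleˡ t (λ k → d · col B k) a) (cong (t *_) (·-assoc d B a))
      e≡td : ∀ j → e j ≡ t * d j
      e≡td j = begin
        e j                                     ≡⟨ ·-scaleˡ t (λ k → d · col B k) (col A′ j) ⟩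
        t * ((λ k → d · col B k) · col A′ j)    ≡⟨ cong (t *_) (·-assoc d B (col A′ j)) ⟩
        t * (d · (λ l → (B ⊗ A′) l j))          ≡⟨ cong (t *_) (·-congˡ d (λ l → BA-sym j l)) ⟩
        t * (d · (B ⊗ A′) j)                    ≡⟨ cong (t *_) (·-comm d ((B ⊗ A′) j)) ⟩
        t * ((B ⊗ A′) j · d)                    ≡⟨ cong (t *_) (BA′d j) ⟩
        t * d j                                 ∎

    open Row row

    B⁺ : Matrix (suc n) m
    B⁺ zero    k = b k
    B⁺ (suc j) k = B j k - d j * b k

    AB⁺ : ∀ i k → (A ⊗ B⁺) i k ≡ (A′ ⊗ B) i k + c i * b k
    AB⁺ i k = begin
      a i * b k + A′ i · (λ j → B j k - d j * b k)
        ≡⟨ cong (λ v → a i * b k + v) (trans (·-minusʳ (A′ i) (col B k) (λ j → d j * b k))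
             (cong (λ v → (A′ ⊗ B) i k - v) (·-scaleʳ (b k) (A′ i) d))) ⟩
      a i * b k + ((A′ ⊗ B) i k - A′ i · d * b k)
        ≡⟨ solve 4 (λ x y z w → x :* y :+ (z :- w :* y) := z :+ (x :- w) :* y) refl
             (a i) (b k) ((A′ ⊗ B) i k) (A′ i · d) ⟩
      (A′ ⊗ B) i k + c i * b k ∎
      where open +-*-Solver

    B⁺A-suc : ∀ i (x : Vector ℚ m) → B⁺ (suc i) · x ≡ B i · x - d i * (b · x)
    B⁺A-suc i x = trans (·-minusˡ (B i) (λ k → d i * b k) x)
                        (cong (λ v → B i · x - v) (·-scaleˡ (d i) b x))

    eB⁺ : ∀ k → e · (λ j → B j k - d j * b k) ≡ e · col B k - e · d * b k
    eB⁺ k = trans (·-minusʳ e (col B k) (λ j → d j * b k))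
                  (cong (λ v → e · col B k - v) (·-scaleʳ (b k) e d))

    mp : IsMoorePenrose A B⁺
    mp = record
      { ABA≋A = aba ; BAB≋B = bab
      ; AB-sym = λ i k → trans (AB⁺ k i) (trans (cong₂ _+_ (AB-sym i k) (cb-sym k i)) (sym (AB⁺ i k)))
      ; BA-sym = ba-sym }
      where
      open +-*-Solver

      aba₀ : ∀ i (x : Vector ℚ m) → (A ⊗ B⁺) i · x ≡ (A′ ⊗ B) i · x + c i * (b · x)
      aba₀ i x = begin
        (A ⊗ B⁺) i · x                              ≡⟨ ·-congʳ x (AB⁺ i) ⟩
        (λ k → (A′ ⊗ B) i k + c i * b k) · x        ≡⟨ ·-plusˡ ((A′ ⊗ B) i) (λ k → c i * b k) x ⟩
        (A′ ⊗ B) i · x + (λ k → c i * b k) · x      ≡⟨ cong (λ v → (A′ ⊗ B) i · x + v) (·-scaleˡ (c i) b x) ⟩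
        (A′ ⊗ B) i · x + c i * (b · x)              ∎

      aba : A ⊗ B⁺ ⊗ A ≋ A
      aba i zero = begin
        (A ⊗ B⁺) i · a                   ≡⟨ aba₀ i a ⟩
        (A′ ⊗ B) i · a + c i * β         ≡⟨ cong₂ _+_ (sym (A′d i)) (cβ i) ⟩
        A′ i · d + (a i - A′ i · d)      ≡⟨ solve 2 (λ x y → x :+ (y :- x) := y) refl (A′ i · d) (a i) ⟩
        a i                              ∎
      aba i (suc j) = begin
        (A ⊗ B⁺) i · col A′ j                    ≡⟨ aba₀ i (col A′ j) ⟩
        (A′ ⊗ B ⊗ A′) i j + c i * e j            ≡⟨ cong₂ _+_ (ABA≋A i j) (ce i j) ⟩
        A′ i j + 0ℚ                              ≡⟨ ℚₚ.+-identityʳ (A′ i j) ⟩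
        A′ i j                                   ∎

      bab : B⁺ ⊗ A ⊗ B⁺ ≋ B⁺
      bab zero    k = trans (cong (λ v → β * b k + v) (eB⁺ k)) (eB k)
      bab (suc i) k = begin
        B⁺ (suc i) · a * b k + (λ j → B⁺ (suc i) · col A′ j) · y
          ≡⟨ cong₂ (λ u v → u * b k + v) (B⁺A-suc i a) (begin
               (λ j → B⁺ (suc i) · col A′ j) · y
                 ≡⟨ ·-congʳ y (λ j → B⁺A-suc i (col A′ j)) ⟩
               (λ j → (B ⊗ A′) i j - d i * e j) · y
                 ≡⟨ ·-minusˡ ((B ⊗ A′) i) (λ j → d i * e j) y ⟩
               (B ⊗ A′) i · y - (λ j → d i * e j) · y
                 ≡⟨ cong₂ _-_
                      (trans (·-minusʳ ((B ⊗ A′) i) (col B k) (λ j → d j * b k))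
                        (cong₂ _-_ (BAB≋B i k)
                          (trans (·-scaleʳ (b k) ((B ⊗ A′) i) d) (cong (_* b k) (BA′d i)))))
                      (trans (·-scaleˡ (d i) e y) (cong (d i *_) (eB⁺ k))) ⟩
               (B i k - d i * b k) - d i * z ∎) ⟩
        (d i - d i * β) * b k + ((B i k - d i * b k) - d i * z)
          ≡⟨ solve 5 (λ d β b B z → (d :- d :* β) :* b :+ ((B :- d :* b) :- d :* z)
                                  := B :- d :* (β :* b :+ z)) refl (d i) β (b k) (B i k) z ⟩
        B i k - d i * (β * b k + z)
          ≡⟨ cong (λ u → B i k - d i * u) (eB k) ⟩
        B i k - d i * b k ∎
        where
        y : Vector ℚ n
        y j = B j k - d j * b k
        z : ℚ
        z = e · col B k - e · d * b k

      de-sym : ∀ i j → d j * e i ≡ d i * e j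
      de-sym i j = trans (cong (d j *_) (e≗ i)) (trans
        (solve 3 (λ x y β → x :* (y :- y :* β) := y :* (x :- x :* β)) refl (d j) (d i) β)
        (cong (d i *_) (sym (e≗ j))))

      ba-sym : (B⁺ ⊗ A) ᵀ ≋ B⁺ ⊗ A
      ba-sym zero    zero    = refl
      ba-sym zero    (suc j) = trans (B⁺A-suc j a) (sym (e≗ j))
      ba-sym (suc i) zero    = trans (e≗ i) (sym (B⁺A-suc i a))
      ba-sym (suc i) (suc j) = trans (B⁺A-suc j (col A′ i)) (trans
        (cong₂ _-_ (BA-sym i j) (de-sym i j)) (sym (B⁺A-suc i (col A′ j))))

abstract
  moorePenrose : ∀ {m n} (A : Matrix m n) → Σ (Matrix n m) (IsMoorePenrose A)
  moorePenrose {m} {zero} A = (λ ()) , record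
    { ABA≋A = λ _ () ; BAB≋B = λ () ; AB-sym = λ _ _ → refl ; BA-sym = λ () }
  moorePenrose {m} {suc n} A = Greville.B⁺ A B B-mp , Greville.mp A B B-mp
    where
    B : Matrix n m
    B = proj₁ (moorePenrose (λ i j → A i (suc j)))
    B-mp : IsMoorePenrose (λ i j → A i (suc j)) B
    B-mp = proj₂ (moorePenrose (λ i j → A i (suc j)))

_⁺ : ∀ {m n} → Matrix m n → Matrix n m
A ⁺ = proj₁ (moorePenrose A)

-- The Laplacian has integer entries, so its Moore–Penrose inverse over the
-- reals is rational and coincides with the one over ℚ.

adjacency : ∀ {n} → SimpleGraph (Fin n) → Matrix n n
adjacency G u v = if adj G u v then 1ℚ else 0ℚ

degree : ∀ {n} → SimpleGraph (Fin n) → Fin n → ℚ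
degree G u = ∑[ v < _ ] adjacency G u v

basis : ∀ {n} → Fin n → Vector ℚ n
basis x i = if does (x ≟ i) then 1ℚ else 0ℚ

laplacian : ∀ {n} → SimpleGraph (Fin n) → Matrix n n
laplacian G u v = (if does (u ≟ v) then degree G u else 0ℚ) - adjacency G u v

resistance : ∀ {n} → SimpleGraph (Fin n) → Fin n → Fin n → ℚ
resistance G x y = ∑[ i < _ ] ∑[ j < _ ] (z i * (laplacian G ⁺) i j * z j)
  where
  z : Vector ℚ _
  z i = basis x i - basis y i

Kf : ∀ {n} → SimpleGraph (Fin n) → ℚ
Kf G = ∑[ x < _ ] ∑[ y < _ ] (if does (x <? y) then resistance G x y else 0ℚ)

-- n - 1 + 3/(n-3) + 1/(n-1) + 2(p-2)/(n-2); none of the truncated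
-- subtractions truncates when n ≥ 4 and p ≥ 2.

lowerBound : (n p : ℕ) → 4 ℕ.≤ n → ℚ
lowerBound n p 4≤n =
  ℤ.+ (n ∸ 1) / 1 + ℤ.+ 3 / (n ∸ 3) + ℤ.+ 1 / (n ∸ 1) + ℤ.+ (2 ℕ.* (p ∸ 2)) / (n ∸ 2)
  where
  instance
    n-1≢0 : NonZero (n ∸ 1)
    n-1≢0 = ℕ.>-nonZero (ℕₚ.m<n⇒0<n∸m {1} {n} (ℕₚ.≤-trans (ℕₚ.m≤m+n 2 2) 4≤n))
    n-2≢0 : NonZero (n ∸ 2)
    n-2≢0 = ℕ.>-nonZero (ℕₚ.m<n⇒0<n∸m {2} {n} (ℕₚ.≤-trans (ℕₚ.m≤m+n 3 1) 4≤n))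
    n-3≢0 : NonZero (n ∸ 3)
    n-3≢0 = ℕ.>-nonZero (ℕₚ.m<n⇒0<n∸m {3} {n} 4≤n)

{-# OPTIONS --safe #-}
-- Write a for the adjacency matrix of F and R for the effective resistance of
-- G = Kₙ − F.  Foster's theorem for G reads Σ (1 − a)(x,y) R(x,y) = 2(n − 1)
-- over ordered pairs, so Kf(G) = n − 1 + Σ_{e ∈ F} R(e).  By Dirichlet's
-- principle the resistance of an edge e ∈ F is at least its value 2/(n − 2) in
-- Kₙ − e, strictly so when e meets another edge of F.  If e and f are adjacent
-- edges of F, then R(e) and R(f) are at least their common value
-- (2n − 3)/((n − 1)(n − 3)) in Kₙ − {e, f}.  Summing over F gives the bound, and
-- equality forces every edge other than e and f to be disjoint from the rest.

module Submission where

open import Defs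

open import Algebra.Bundles using (CommutativeRing)
open import Data.Bool.Base using (true; false; T; not; _∧_; if_then_else_)
open import Data.Bool.Properties using (T?)
open import Data.Empty using (⊥-elim)
open import Data.Fin.Base as Fin using (Fin; zero; suc)
open import Data.Fin.Patterns using (0F; 1F; 2F)
open import Data.Fin.Properties as Finₚ using (_≟_; _<?_)
import Data.Integer.Base as ℤ
import Data.Integer.Properties as ℤₚ
open import Data.Irrelevant using ([_])
open import Data.Nat.Base as ℕ using (ℕ; zero; suc; _∸_; _*_; _⊔_; _≤_; z≤n; s≤s)
open import Data.Nat.Properties as ℕₚ using (m⊔n≤o⇒m≤o)
import Data.Nat.Solver as ℕ-Solver
open import Data.Product.Base using (∃; _×_; _,_; proj₁; proj₂)
open import Data.Rational.Base as ℚ using (ℚ; 0ℚ; 1ℚ)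
  renaming (_+_ to _⊕_; _*_ to _⊛_; _-_ to _⊖_)
import Data.Rational.Properties as ℚₚ
open import Data.Rational.Solver using (module +-*-Solver)
import Data.Rational.Unnormalised.Base as ℚᵘ
import Data.Rational.Unnormalised.Properties as ℚᵘₚ
open import Data.Refinement.Base using (value) renaming (_,_ to _,ʳ_)
open import Data.Sum.Base using (_⊎_; inj₁; inj₂; swap)
open import Data.Sum.Function.Propositional using (_⊎-↔_)
open import Data.Vec.Functional using (Vector)
open import Function.Bundles using (_↔_; Inverse; mk↔ₛ′; _⇔_; mk⇔)
open import Function.Properties.Inverse using (↔-refl; ↔-trans)
open import Relation.Binary.Construct.Closure.ReflexiveTransitive using (Star; ε; _◅_)
open import Relation.Binary.Definitions using (tri<; tri≈; tri>)
open import Relation.Binary.PropositionalEquality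
open import Relation.Nullary using (¬_; Dec; does; yes; no)
open import Relation.Nullary.Decidable using (dec-true; dec-false; recompute; ¬?; _×-dec_)
open import Relation.Unary using (Decidable)

open import Algebra.Properties.Monoid.Sum ℕₚ.+-0-monoid
  using () renaming (sum to sumℕ)
open import Algebra.Properties.Semiring.Sum
  (CommutativeRing.semiring ℚₚ.+-*-commutativeRing)

open +-*-Solver using (solve; _:=_; _:+_; _:*_; _:-_; :-_; con)
open ≡-Reasoning

-- The pseudoinverse of the Laplacian of G is used only through its four Penrose equations, and no
-- general resistance of G is computed. Foster's theorem then needs just the trace of LX, which is n
-- - 1 because I - LX has constant rows and column sums 1. Explicit potentials are required only for
-- Kₙ - e and Kₙ - {e, f}: on vectors of sum zero Kₙ acts as multiplication by n and each deleted
-- edge as a rank-one term, so a combination of the deleted dipoles solves the equation. To settle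
-- the case of equality, the estimates are kept as identities with non-negative remainders.
-- Dirichlet's principle retains the energy of the test potential on the remaining edges of F, and
-- this term makes the estimate for R(e) strict once e has a neighbour in F. Globally, 2 Kf(G) is
-- twice the bound plus the sum of a non-negative slack matrix, so equality annihilates every entry.
-- Sums run over ordered pairs, hence the recurring factor two.

2ℚ : ℚ
2ℚ = 1ℚ ⊕ 1ℚ

-- Built by repeated addition so that `ι` of a successor unfolds to a sum visible to the ring
-- solver, whereas a quotient formed by `_/_` is stuck on its normalisation.
ι : ℕ → ℚ
ι zero    = 0ℚ
ι (suc k) = 1ℚ ⊕ ι k

-- Finite sums, double sums and order in ℚ

∑-1 : ∀ n → ∑[ i < n ] 1ℚ ≡ ι n
∑-1 zero    = refl
∑-1 (suc n) = cong (1ℚ ⊕_) (∑-1 n)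

∑-minus : ∀ {n} (f g : Vector ℚ n) → ∑[ i < n ] (f i ⊖ g i) ≡ sum f ⊖ sum g
∑-minus {zero}  f g = refl
∑-minus {suc n} f g = trans (cong ((f zero ⊖ g zero) ⊕_) (∑-minus (λ i → f (suc i)) (λ i → g (suc i))))
  (solve 4 (λ a b x y → (a :- b) :+ (x :- y) := (a :+ x) :- (b :+ y)) refl (f zero) (g zero) _ _)

∑-zero : ∀ {n} (f : Vector ℚ n) → (∀ i → f i ≡ 0ℚ) → sum f ≡ 0ℚ
∑-zero {n} f f≡0 = trans (sum-cong-≗ f≡0) (sum-replicate-zero n)

∑∑ : ∀ {m n} → Matrix m n → ℚ
∑∑ {m} {n} f = ∑[ x < m ] ∑[ y < n ] f x y

∑∑-cong : ∀ {m n} {f g : Matrix m n} → f ≋ g → ∑∑ f ≡ ∑∑ g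
∑∑-cong f≋g = sum-cong-≗ λ x → sum-cong-≗ (f≋g x)

∑∑-plus : ∀ {m n} (f g : Matrix m n) → ∑∑ (λ x y → f x y ⊕ g x y) ≡ ∑∑ f ⊕ ∑∑ g
∑∑-plus f g = trans (sum-cong-≗ λ x → ∑-distrib-+ (f x) (g x))
                    (∑-distrib-+ (λ x → sum (f x)) (λ x → sum (g x)))

∑∑-minus : ∀ {m n} (f g : Matrix m n) → ∑∑ (λ x y → f x y ⊖ g x y) ≡ ∑∑ f ⊖ ∑∑ g
∑∑-minus f g = trans (sum-cong-≗ λ x → ∑-minus (f x) (g x))
                     (∑-minus (λ x → sum (f x)) (λ x → sum (g x)))

∑∑-scale : ∀ {m n} c (f : Matrix m n) → ∑∑ (λ x y → c ⊛ f x y) ≡ c ⊛ ∑∑ f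
∑∑-scale c f = trans (sum-cong-≗ λ x → sym (*-distribˡ-sum c (f x)))
                     (sym (*-distribˡ-sum c (λ x → sum (f x))))

-- Sums over ordered pairs count each edge twice; cancelling the two copies here spares all later
-- identities a factor 1/2.
≤-double : ∀ {x y} → x ⊕ x ℚ.≤ y ⊕ y → x ℚ.≤ y
≤-double 2x≤2y = ℚₚ.≮⇒≥ λ y<x → ℚₚ.<-irrefl refl (ℚₚ.<-≤-trans (ℚₚ.+-mono-< y<x y<x) 2x≤2y)

≡-double : ∀ {x y} → x ⊕ x ≡ y ⊕ y → x ≡ y
≡-double eq = ℚₚ.≤-antisym (≤-double (ℚₚ.≤-reflexive eq)) (≤-double (ℚₚ.≤-reflexive (sym eq)))

⊛-nonneg : ∀ {x y} → 0ℚ ℚ.≤ x → 0ℚ ℚ.≤ y → 0ℚ ℚ.≤ x ⊛ y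
⊛-nonneg {x} {y} 0≤x 0≤y = subst (ℚ._≤ x ⊛ y) (ℚₚ.*-zeroʳ x)
  (ℚₚ.*-monoˡ-≤-nonNeg x {{ℚ.nonNegative 0≤x}} 0≤y)

square-nonneg : ∀ x → 0ℚ ℚ.≤ x ⊛ x
square-nonneg x with ℚₚ.≤-total 0ℚ x
... | inj₁ 0≤x = ⊛-nonneg 0≤x 0≤x
... | inj₂ x≤0 = subst (0ℚ ℚ.≤_)
  (solve 1 (λ x → (:- x) :* (:- x) := x :* x) refl x) (⊛-nonneg 0≤-x 0≤-x)
  where
  0≤-x = ℚₚ.neg-antimono-≤ x≤0

⊛-cancelˡ : ∀ x {y} → x ≢ 0ℚ → x ⊛ y ≡ 0ℚ → y ≡ 0ℚ
⊛-cancelˡ x {y} x≢0 eq = begin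
  y                  ≡⟨ ℚₚ.*-identityˡ y ⟨
  1ℚ ⊛ y             ≡⟨ cong (_⊛ y) (ℚₚ.*-inverseˡ x) ⟨
  ℚ.1/ x ⊛ x ⊛ y     ≡⟨ ℚₚ.*-assoc (ℚ.1/ x) x y ⟩
  ℚ.1/ x ⊛ (x ⊛ y)   ≡⟨ cong (ℚ.1/ x ⊛_) eq ⟩
  ℚ.1/ x ⊛ 0ℚ        ≡⟨ ℚₚ.*-zeroʳ (ℚ.1/ x) ⟩
  0ℚ                 ∎
  where instance _ = ℚ.≢-nonZero x≢0

square-zero : ∀ x → x ⊛ x ≡ 0ℚ → x ≡ 0ℚ
square-zero x eq with x ℚₚ.≟ 0ℚ
... | yes x≡0 = x≡0
... | no  x≢0 = ⊛-cancelˡ x x≢0 eq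

⊖-zero : ∀ {x y} → x ⊖ y ≡ 0ℚ → x ≡ y
⊖-zero {x} {y} eq = begin
  x            ≡⟨ solve 2 (λ x y → x := (x :- y) :+ y) refl x y ⟩
  (x ⊖ y) ⊕ y  ≡⟨ cong (_⊕ y) eq ⟩
  0ℚ ⊕ y       ≡⟨ ℚₚ.+-identityˡ y ⟩
  y            ∎

⊖-self : ∀ {x y} → x ≡ y → x ⊖ y ≡ 0ℚ
⊖-self {x} refl = ℚₚ.+-inverseʳ x

⊖-nonneg : ∀ {p q} → p ℚ.≤ q → 0ℚ ℚ.≤ q ⊖ p
⊖-nonneg {p} {q} p≤q = subst (ℚ._≤ q ⊖ p) (ℚₚ.+-inverseʳ p) (ℚₚ.+-monoˡ-≤ (ℚ.- p) p≤q)

∑-nonneg : ∀ {n} (f : Vector ℚ n) → (∀ i → 0ℚ ℚ.≤ f i) → 0ℚ ℚ.≤ sum f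
∑-nonneg {zero}  f 0≤f = ℚₚ.≤-refl
∑-nonneg {suc n} f 0≤f = ℚₚ.+-mono-≤ (0≤f zero) (∑-nonneg (λ i → f (suc i)) (λ i → 0≤f (suc i)))

term≤∑ : ∀ {n} (f : Vector ℚ n) → (∀ i → 0ℚ ℚ.≤ f i) → ∀ i → f i ℚ.≤ sum f
term≤∑ f 0≤f zero    = subst (ℚ._≤ sum f) (ℚₚ.+-identityʳ (f zero))
  (ℚₚ.+-monoʳ-≤ (f zero) (∑-nonneg (λ i → f (suc i)) (λ i → 0≤f (suc i))))
term≤∑ f 0≤f (suc i) = subst (ℚ._≤ sum f) (ℚₚ.+-identityˡ (f (suc i)))
  (ℚₚ.+-mono-≤ (0≤f zero) (term≤∑ (λ i → f (suc i)) (λ i → 0≤f (suc i)) i))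

∑∑-nonneg : ∀ {m n} (f : Matrix m n) → (∀ x y → 0ℚ ℚ.≤ f x y) → 0ℚ ℚ.≤ ∑∑ f
∑∑-nonneg f 0≤f = ∑-nonneg (λ x → sum (f x)) λ x → ∑-nonneg (f x) (0≤f x)

-- The rigidity principle behind all equality arguments: it is applied to the energy of a harmonic
-- function, to the energy on deleted edges and to the slack matrix.
∑∑-nonpos⇒zero : ∀ {m n} (f : Matrix m n) → (∀ x y → 0ℚ ℚ.≤ f x y) → ∑∑ f ℚ.≤ 0ℚ →
                 ∀ x y → f x y ≡ 0ℚ
∑∑-nonpos⇒zero f 0≤f ∑≤0 x y = ℚₚ.≤-antisym
  (ℚₚ.≤-trans (term≤∑ (f x) (0≤f x) y)
    (ℚₚ.≤-trans (term≤∑ (λ x → sum (f x)) (λ x → ∑-nonneg (f x) (0≤f x)) x) ∑≤0))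
  (0≤f x y)

-- Standard basis vectors and dipoles

basis-refl : ∀ {n} (x : Fin n) → basis x x ≡ 1ℚ
basis-refl x = cong (if_then 1ℚ else 0ℚ) (dec-true (x ≟ x) refl)

basis-≢ : ∀ {n} {x y : Fin n} → x ≢ y → basis x y ≡ 0ℚ
basis-≢ {x = x} {y} x≢y = cong (if_then 1ℚ else 0ℚ) (dec-false (x ≟ y) x≢y)

basis-sym : ∀ {n} (x y : Fin n) → basis x y ≡ basis y x
basis-sym x y with x ≟ y
... | yes refl = sym (basis-refl x)
... | no  x≢y  = sym (basis-≢ (λ y≡x → x≢y (sym y≡x)))

basis-subst : ∀ {n} (f : Vector ℚ n) x y → basis x y ⊛ f y ≡ basis x y ⊛ f x
basis-subst f x y with x ≟ y
... | yes refl = refl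
... | no  _    = trans (ℚₚ.*-zeroˡ (f y)) (sym (ℚₚ.*-zeroˡ (f x)))

∑-basis : ∀ {n} x (f : Vector ℚ n) → ∑[ i < n ] (basis x i ⊛ f i) ≡ f x
∑-basis {suc n} zero f = begin
  1ℚ ⊛ f zero ⊕ ∑[ i < n ] (0ℚ ⊛ f (suc i))  ≡⟨ cong₂ _⊕_ (ℚₚ.*-identityˡ (f zero))
                                                   (∑-zero _ (λ i → ℚₚ.*-zeroˡ (f (suc i)))) ⟩
  f zero ⊕ 0ℚ                                ≡⟨ ℚₚ.+-identityʳ (f zero) ⟩
  f zero                                     ∎
∑-basis {suc n} (suc x) f = begin
  0ℚ ⊛ f zero ⊕ ∑[ i < n ] (basis x i ⊛ f (suc i))
    ≡⟨ cong₂ _⊕_ (ℚₚ.*-zeroˡ (f zero)) (∑-basis x (λ i → f (suc i))) ⟩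
  0ℚ ⊕ f (suc x)  ≡⟨ ℚₚ.+-identityˡ (f (suc x)) ⟩
  f (suc x)       ∎

∑-basis-1 : ∀ {n} (x : Fin n) → sum (basis x) ≡ 1ℚ
∑-basis-1 x = trans (sum-cong-≗ λ i → sym (ℚₚ.*-identityʳ (basis x i))) (∑-basis x (λ _ → 1ℚ))

-- Definitionally the vector `z` inside `resistance`; as a current it enters at `x` and leaves at
-- `y`.
dipole : ∀ {n} → Fin n → Fin n → Vector ℚ n
dipole x y i = basis x i ⊖ basis y i

∑-dipole : ∀ {n} x y (f : Vector ℚ n) → ∑[ i < n ] (dipole x y i ⊛ f i) ≡ f x ⊖ f y
∑-dipole x y f = begin
  ∑[ i < _ ] (dipole x y i ⊛ f i)
    ≡⟨ sum-cong-≗ (λ i → solve 3 (λ a b c → (a :- b) :* c := a :* c :- b :* c) refl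
         (basis x i) (basis y i) (f i)) ⟩
  ∑[ i < _ ] (basis x i ⊛ f i ⊖ basis y i ⊛ f i)
    ≡⟨ ∑-minus (λ i → basis x i ⊛ f i) (λ i → basis y i ⊛ f i) ⟩
  ∑[ i < _ ] (basis x i ⊛ f i) ⊖ ∑[ i < _ ] (basis y i ⊛ f i)
    ≡⟨ cong₂ _⊖_ (∑-basis x f) (∑-basis y f) ⟩
  f x ⊖ f y ∎

-- Trichotomy puts each ordered pair off the diagonal into exactly one of the two halves. This
-- serves both `Kf` and `size`, which sum over `x <? y`.
∑∑-symmetric : ∀ {n} (f : Matrix n n) → f ᵀ ≋ f → (∀ x → f x x ≡ 0ℚ) →
               ∑∑ f ≡ ∑∑ (λ x y → if does (x <? y) then f x y else 0ℚ)
                      ⊕ ∑∑ (λ x y → if does (x <? y) then f x y else 0ℚ)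
∑∑-symmetric f f-sym f-diag = begin
  ∑∑ f                                     ≡⟨ ∑∑-cong split ⟩
  ∑∑ (λ x y → half x y ⊕ half y x)         ≡⟨ ∑∑-plus half (λ x y → half y x) ⟩
  ∑∑ half ⊕ ∑∑ (λ x y → half y x)          ≡⟨ cong (∑∑ half ⊕_) (∑-comm (λ x y → half y x)) ⟩
  ∑∑ half ⊕ ∑∑ half                        ∎
  where
  half : Matrix _ _
  half x y = if does (x <? y) then f x y else 0ℚ
  half-< : ∀ x y → does (x <? y) ≡ true → half x y ≡ f x y
  half-< x y = cong (if_then f x y else 0ℚ)
  half-≮ : ∀ x y → does (x <? y) ≡ false → half x y ≡ 0ℚ
  half-≮ x y = cong (if_then f x y else 0ℚ)
  split : ∀ x y → f x y ≡ half x y ⊕ half y x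
  split x y with Finₚ.<-cmp x y
  ... | tri< x<y _ y≮x = sym (trans (cong₂ _⊕_ (half-< x y (dec-true (x <? y) x<y)) (half-≮ y x (dec-false (y <? x) y≮x)))
                                    (ℚₚ.+-identityʳ (f x y)))
  ... | tri> x≮y _ y<x = sym (trans (cong₂ _⊕_ (half-≮ x y (dec-false (x <? y) x≮y)) (half-< y x (dec-true (y <? x) y<x)))
                                    (trans (ℚₚ.+-identityˡ (f y x)) (f-sym x y)))
  ... | tri≈ x≮y refl y≮x = trans (f-diag x)
        (sym (cong₂ _⊕_ (half-≮ x x (dec-false (x <? x) x≮y)) (half-≮ x x (dec-false (x <? x) x≮y))))

-- Weighted Laplacians

op : ∀ {n} → Matrix n n → Vector ℚ n → Vector ℚ n
op A w x = ∑[ y < _ ] (A x y ⊛ (w x ⊖ w y))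

form : ∀ {n} → Matrix n n → Vector ℚ n → Vector ℚ n → ℚ
form A f g = ∑∑ λ x y → A x y ⊛ ((f x ⊖ f y) ⊛ (g x ⊖ g y))

infix 8 _∙_

_∙_ : ∀ {n} → Vector ℚ n → Vector ℚ n → ℚ
x ∙ y = ∑[ i < _ ] (x i ⊛ y i)

-- Discrete Green identity. Splitting the factor `f x ⊖ f y` gives two sums that exchange of `x` and
-- `y` carries into each other, hence the two equal copies.
form-op : ∀ {n} (A : Matrix n n) → A ᵀ ≋ A → ∀ f g → form A f g ≡ f ∙ op A g ⊕ f ∙ op A g
form-op A A-sym f g = begin
  form A f g
    ≡⟨ ∑∑-cong (λ x y → trans
         (solve 5 (λ a p q r s → a :* ((p :- q) :* (r :- s))
                   := p :* (a :* (r :- s)) :+ q :* (a :* (s :- r))) refl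
           (A x y) (f x) (f y) (g x) (g y))
         (cong (λ a → t x y ⊕ f y ⊛ (a ⊛ (g y ⊖ g x))) (A-sym y x))) ⟩
  ∑∑ (λ x y → t x y ⊕ t y x)           ≡⟨ ∑∑-plus t (λ x y → t y x) ⟩
  ∑∑ t ⊕ ∑∑ (λ x y → t y x)            ≡⟨ cong (∑∑ t ⊕_) (∑-comm (λ x y → t y x)) ⟩
  ∑∑ t ⊕ ∑∑ t                          ≡⟨ cong₂ _⊕_ ∑∑t ∑∑t ⟩
  f ∙ op A g ⊕ f ∙ op A g              ∎
  where
  t : Matrix _ _
  t x y = f x ⊛ (A x y ⊛ (g x ⊖ g y))
  ∑∑t : ∑∑ t ≡ f ∙ op A g
  ∑∑t = sum-cong-≗ λ x → sym (*-distribˡ-sum (f x) (λ y → A x y ⊛ (g x ⊖ g y)))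

form-comm : ∀ {n} (A : Matrix n n) f g → form A f g ≡ form A g f
form-comm A f g = ∑∑-cong λ x y → cong (A x y ⊛_) (ℚₚ.*-comm (f x ⊖ f y) (g x ⊖ g y))

form-nonneg : ∀ {n} (A : Matrix n n) → (∀ x y → 0ℚ ℚ.≤ A x y) → ∀ f → 0ℚ ℚ.≤ form A f f
form-nonneg A 0≤A f = ∑∑-nonneg _ λ x y → ⊛-nonneg (0≤A x y) (square-nonneg (f x ⊖ f y))

op-selfAdjoint : ∀ {n} (A : Matrix n n) → A ᵀ ≋ A → ∀ f g → f ∙ op A g ≡ g ∙ op A f
op-selfAdjoint A A-sym f g = ≡-double
  (trans (sym (form-op A A-sym f g)) (trans (form-comm A f g) (form-op A A-sym g f)))

form-minus : ∀ {n} (A : Matrix n n) f g →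
             form A (λ x → f x ⊖ g x) (λ x → f x ⊖ g x) ≡ form A f f ⊖ 2ℚ ⊛ form A f g ⊕ form A g g
form-minus A f g = begin
  form A (λ x → f x ⊖ g x) (λ x → f x ⊖ g x)
    ≡⟨ ∑∑-cong (λ x y →
         solve 5 (λ a p q r s → a :* (((p :- r) :- (q :- s)) :* ((p :- r) :- (q :- s)))
                   := (a :* ((p :- q) :* (p :- q)) :- con 2ℚ :* (a :* ((p :- q) :* (r :- s))))
                      :+ a :* ((r :- s) :* (r :- s))) refl
           (A x y) (f x) (f y) (g x) (g y)) ⟩
  ∑∑ (λ x y → ff x y ⊖ 2ℚ ⊛ fg x y ⊕ gg x y)
    ≡⟨ ∑∑-plus (λ x y → ff x y ⊖ 2ℚ ⊛ fg x y) gg ⟩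
  ∑∑ (λ x y → ff x y ⊖ 2ℚ ⊛ fg x y) ⊕ ∑∑ gg
    ≡⟨ cong (_⊕ ∑∑ gg) (trans (∑∑-minus ff (λ x y → 2ℚ ⊛ fg x y))
         (cong (∑∑ ff ⊖_) (∑∑-scale 2ℚ fg))) ⟩
  form A f f ⊖ 2ℚ ⊛ form A f g ⊕ form A g g ∎
  where
  ff fg gg : Matrix _ _
  ff x y = A x y ⊛ ((f x ⊖ f y) ⊛ (f x ⊖ f y))
  fg x y = A x y ⊛ ((f x ⊖ f y) ⊛ (g x ⊖ g y))
  gg x y = A x y ⊛ ((g x ⊖ g y) ⊛ (g x ⊖ g y))

form-minusʷ : ∀ {n} (A B : Matrix n n) f g →
              form (λ x y → A x y ⊖ B x y) f g ≡ form A f g ⊖ form B f g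
form-minusʷ A B f g = trans
  (∑∑-cong λ x y → solve 3 (λ a b c → (a :- b) :* c := a :* c :- b :* c) refl
     (A x y) (B x y) ((f x ⊖ f y) ⊛ (g x ⊖ g y)))
  (∑∑-minus (λ x y → A x y ⊛ ((f x ⊖ f y) ⊛ (g x ⊖ g y)))
            (λ x y → B x y ⊛ ((f x ⊖ f y) ⊛ (g x ⊖ g y))))

op-minusʷ : ∀ {n} (A B : Matrix n n) w x →
            op (λ x y → A x y ⊖ B x y) w x ≡ op A w x ⊖ op B w x
op-minusʷ A B w x = trans
  (sum-cong-≗ λ y → solve 3 (λ a b c → (a :- b) :* c := a :* c :- b :* c) refl (A x y) (B x y) (w x ⊖ w y))
  (∑-minus (λ y → A x y ⊛ (w x ⊖ w y)) (λ y → B x y ⊛ (w x ⊖ w y)))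

∙-cong : ∀ {n} (x : Vector ℚ n) {y z : Vector ℚ n} → (∀ i → y i ≡ z i) → x ∙ y ≡ x ∙ z
∙-cong x y≗z = sum-cong-≗ λ i → cong (x i ⊛_) (y≗z i)

-- Dirichlet's principle: for the weights A − d the potential w of b with
-- respect to A is only a test vector.
module Dirichlet {n} (A d : Matrix n n) (A-sym : A ᵀ ≋ A) (d-sym : d ᵀ ≋ d)
                 (b g w : Vector ℚ n) (A∖d : Matrix n n)
                 (A∖d≡ : ∀ x y → A∖d x y ≡ A x y ⊖ d x y)
                 (opg≡b : ∀ x → op A∖d g x ≡ b x) (opw≡b : ∀ x → op A w x ≡ b x) where


  A∖d-sym : A∖d ᵀ ≋ A∖d
  A∖d-sym x y = trans (A∖d≡ y x) (trans (cong₂ _⊖_ (A-sym x y) (d-sym x y)) (sym (A∖d≡ x y)))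

  -- Since `g` solves the equation for the reduced weights, its square and its cross term with `w`
  -- are pairings with `b`, while the square of `w` is its energy for `A` less its energy on `d`.
  -- Completing the square isolates two remainders; the energy on `d` is the one that later detects
  -- equality.
  energy : g ∙ b ⊕ g ∙ b ≡ (w ∙ b ⊕ w ∙ b) ⊕ form d w w ⊕ form A∖d (λ x → g x ⊖ w x) (λ x → g x ⊖ w x)
  energy = begin
    g ∙ b ⊕ g ∙ b
      ≡⟨ solve 3 (λ G W D → G :+ G := (W :+ W) :+ D :+
           (((G :+ G) :- con 2ℚ :* (W :+ W)) :+ ((W :+ W) :- D))) refl (g ∙ b) (w ∙ b) (form d w w) ⟩
    (w ∙ b ⊕ w ∙ b) ⊕ form d w w ⊕
      (((g ∙ b ⊕ g ∙ b) ⊖ 2ℚ ⊛ (w ∙ b ⊕ w ∙ b)) ⊕ ((w ∙ b ⊕ w ∙ b) ⊖ form d w w))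
      ≡⟨ cong ((w ∙ b ⊕ w ∙ b) ⊕ form d w w ⊕_) (sym (begin
           form A∖d (λ x → g x ⊖ w x) (λ x → g x ⊖ w x)
             ≡⟨ form-minus A∖d g w ⟩
           form A∖d g g ⊖ 2ℚ ⊛ form A∖d g w ⊕ form A∖d w w
             ≡⟨ cong₂ _⊕_ (cong₂ (λ u v → u ⊖ 2ℚ ⊛ v) gg gw) ww ⟩
           ((g ∙ b ⊕ g ∙ b) ⊖ 2ℚ ⊛ (w ∙ b ⊕ w ∙ b)) ⊕ ((w ∙ b ⊕ w ∙ b) ⊖ form d w w) ∎)) ⟩
    (w ∙ b ⊕ w ∙ b) ⊕ form d w w ⊕ form A∖d (λ x → g x ⊖ w x) (λ x → g x ⊖ w x) ∎
    where
    gg : form A∖d g g ≡ g ∙ b ⊕ g ∙ b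
    gg = trans (form-op A∖d A∖d-sym g g) (cong₂ _⊕_ (∙-cong g opg≡b) (∙-cong g opg≡b))
    gw : form A∖d g w ≡ w ∙ b ⊕ w ∙ b
    gw = trans (form-comm A∖d g w) (trans (form-op A∖d A∖d-sym w g)
           (cong₂ _⊕_ (∙-cong w opg≡b) (∙-cong w opg≡b)))
    ww : form A∖d w w ≡ (w ∙ b ⊕ w ∙ b) ⊖ form d w w
    ww = trans (∑∑-cong (λ x y → cong (_⊛ _) (A∖d≡ x y))) (trans (form-minusʷ A d w w)
           (cong (_⊖ form d w w) (trans (form-op A A-sym w w)
             (cong₂ _⊕_ (∙-cong w opw≡b) (∙-cong w opw≡b)))))

  lower : (∀ x y → 0ℚ ℚ.≤ A∖d x y) → (w ∙ b ⊕ w ∙ b) ⊕ form d w w ℚ.≤ g ∙ b ⊕ g ∙ b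
  lower 0≤A∖d = subst₂ ℚ._≤_ (ℚₚ.+-identityʳ _) (sym energy)
    (ℚₚ.+-monoʳ-≤ ((w ∙ b ⊕ w ∙ b) ⊕ form d w w) (form-nonneg A∖d 0≤A∖d (λ x → g x ⊖ w x)))

  -- If `d` joins only equal values of `w`, then `w` solves the reduced equation too. Solutions may
  -- differ by an element of the kernel, so self-adjointness matches the pairings instead of the
  -- vectors.
  exact : (∀ x y → d x y ⊛ (w x ⊖ w y) ≡ 0ℚ) → g ∙ b ≡ w ∙ b
  exact dw≡0 = begin
    g ∙ b           ≡⟨ ∙-cong g (λ x → sym (opA∖dw≡b x)) ⟩
    g ∙ op A∖d w    ≡⟨ op-selfAdjoint A∖d A∖d-sym g w ⟩
    w ∙ op A∖d g    ≡⟨ ∙-cong w opg≡b ⟩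
    w ∙ b           ∎
    where
    opA∖dw≡b : ∀ x → op A∖d w x ≡ b x
    opA∖dw≡b x = trans (sum-cong-≗ λ y → begin
      A∖d x y ⊛ (w x ⊖ w y)             ≡⟨ cong (_⊛ (w x ⊖ w y)) (A∖d≡ x y) ⟩
      (A x y ⊖ d x y) ⊛ (w x ⊖ w y)     ≡⟨ solve 3 (λ a b c → (a :- b) :* c := a :* c :- b :* c) refl
                                             (A x y) (d x y) (w x ⊖ w y) ⟩
      A x y ⊛ (w x ⊖ w y) ⊖ d x y ⊛ (w x ⊖ w y)
                                        ≡⟨ cong (A x y ⊛ (w x ⊖ w y) ⊖_) (dw≡0 x y) ⟩
      A x y ⊛ (w x ⊖ w y) ⊖ 0ℚ          ≡⟨ ℚₚ.+-identityʳ _ ⟩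
      A x y ⊛ (w x ⊖ w y)               ∎) (opw≡b x)

-- The pseudoinverse of the Laplacian and Foster's theorem

if-basis : ∀ b c → (if b then c else 0ℚ) ≡ c ⊛ (if b then 1ℚ else 0ℚ)
if-basis true  c = sym (ℚₚ.*-identityʳ c)
if-basis false c = sym (ℚₚ.*-zeroʳ c)

adjacency-sym : ∀ {n} (G : SimpleGraph (Fin n)) → adjacency G ᵀ ≋ adjacency G
adjacency-sym G x y = cong (if_then 1ℚ else 0ℚ) (adj-sym G y x)

adjacency-01 : ∀ {n} (G : SimpleGraph (Fin n)) x y →
               (Adj G x y × adjacency G x y ≡ 1ℚ) ⊎ (¬ Adj G x y × adjacency G x y ≡ 0ℚ)
adjacency-01 G x y with adj G x y
... | true  = inj₁ (_ , refl)
... | false = inj₂ ((λ ()) , refl)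

module Foster {n} (F : EdgeSet n) (connected : Connected (K n ∖ F)) where

  G : SimpleGraph (Fin n)
  G = K n ∖ F

  a co : Matrix n n
  a = adjacency F
  co x y = 1ℚ ⊖ a x y

  L X : Matrix n n
  L = laplacian G
  X = L ⁺

  open IsMoorePenrose (proj₂ (moorePenrose L))

  co-sym : co ᵀ ≋ co
  co-sym x y = cong (1ℚ ⊖_) (adjacency-sym F x y)

  co-nonneg : ∀ x y → 0ℚ ℚ.≤ co x y
  co-nonneg x y with adjacency-01 F x y
  ... | inj₁ (_ , eq) = ℚₚ.≤-reflexive (sym (cong (1ℚ ⊖_) eq))
  ... | inj₂ (_ , eq) = subst (0ℚ ℚ.≤_) (cong (1ℚ ⊖_) (sym eq)) (ℚₚ.nonNegative⁻¹ 1ℚ)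

  -- On the diagonal `co` is 1 and the adjacency 0, but there the difference of `w` vanishes. Hence
  -- the Laplacian of G is `op` of the plain matrix 1 - a.
  adjacency-co : ∀ (w : Vector ℚ n) x y → adjacency G x y ⊛ (w x ⊖ w y) ≡ co x y ⊛ (w x ⊖ w y)
  adjacency-co w x y with x ≟ y
  ... | yes refl = trans (ℚₚ.*-zeroˡ (w x ⊖ w x)) (sym (trans (cong (co x x ⊛_) (ℚₚ.+-inverseʳ (w x))) (ℚₚ.*-zeroʳ (co x x))))
  ... | no  _ with adj F x y
  ...   | true  = refl
  ...   | false = refl

  L-entry : ∀ x y → L x y ≡ basis x y ⊛ degree G x ⊖ adjacency G x y
  L-entry x y = cong (_⊖ adjacency G x y)
    (trans (if-basis (does (x ≟ y)) (degree G x)) (ℚₚ.*-comm (degree G x) (basis x y)))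

  L-op : ∀ (w : Vector ℚ n) x → L x ∙ w ≡ op co w x
  L-op w x = begin
    L x ∙ w
      ≡⟨ sum-cong-≗ (λ y → trans
           (cong (_⊛ w y) (L-entry x y))
           (solve 4 (λ d b a w → (b :* d :- a) :* w := d :* (b :* w) :- a :* w) refl
             (degree G x) (basis x y) (adjacency G x y) (w y))) ⟩
    ∑[ y < n ] (degree G x ⊛ (basis x y ⊛ w y) ⊖ adjacency G x y ⊛ w y)
      ≡⟨ ∑-minus (λ y → degree G x ⊛ (basis x y ⊛ w y)) (λ y → adjacency G x y ⊛ w y) ⟩
    ∑[ y < n ] (degree G x ⊛ (basis x y ⊛ w y)) ⊖ adjacency G x ∙ w
      ≡⟨ cong (_⊖ adjacency G x ∙ w) (begin
           ∑[ y < n ] (degree G x ⊛ (basis x y ⊛ w y)) ≡⟨ *-distribˡ-sum (degree G x) (λ y → basis x y ⊛ w y) ⟨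
           degree G x ⊛ ∑[ y < n ] (basis x y ⊛ w y)   ≡⟨ cong (degree G x ⊛_) (∑-basis x w) ⟩
           degree G x ⊛ w x                            ≡⟨ *-distribʳ-sum (w x) (adjacency G x) ⟩
           ∑[ y < n ] (adjacency G x y ⊛ w x)          ∎) ⟩
    ∑[ y < n ] (adjacency G x y ⊛ w x) ⊖ adjacency G x ∙ w
      ≡⟨ ∑-minus (λ y → adjacency G x y ⊛ w x) (λ y → adjacency G x y ⊛ w y) ⟨
    ∑[ y < n ] (adjacency G x y ⊛ w x ⊖ adjacency G x y ⊛ w y)
      ≡⟨ sum-cong-≗ (λ y → trans
           (solve 3 (λ a v w → a :* v :- a :* w := a :* (v :- w)) refl (adjacency G x y) (w x) (w y))
           (adjacency-co w x y)) ⟩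
    op co w x ∎

  L-sym : L ᵀ ≋ L
  L-sym x y = begin
    L y x                                        ≡⟨ L-entry y x ⟩
    basis y x ⊛ degree G y ⊖ adjacency G y x     ≡⟨ cong₂ (λ u v → u ⊛ degree G y ⊖ v) (basis-sym y x) (adjacency-sym G x y) ⟩
    basis x y ⊛ degree G y ⊖ adjacency G x y     ≡⟨ cong (_⊖ adjacency G x y) (basis-subst (degree G) x y) ⟩
    basis x y ⊛ degree G x ⊖ adjacency G x y     ≡⟨ L-entry x y ⟨
    L x y                                        ∎

  ∑-L : ∀ y → ∑[ x < n ] L x y ≡ 0ℚ
  ∑-L y = begin
    ∑[ x < n ] L x y           ≡⟨ sum-cong-≗ (λ x → trans (L-sym y x) (sym (ℚₚ.*-identityʳ (L y x)))) ⟩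
    L y ∙ (λ _ → 1ℚ)           ≡⟨ L-op (λ _ → 1ℚ) y ⟩
    op co (λ _ → 1ℚ) y         ≡⟨ ∑-zero (λ x → co y x ⊛ 0ℚ) (λ x → ℚₚ.*-zeroʳ (co y x)) ⟩
    0ℚ                         ∎

  -- A harmonic function has zero energy, so it agrees across every edge of G, and a path carries
  -- the agreement from `x` to `y`. This is where connectivity enters Foster's theorem.
  harmonic⇒constant : ∀ (f : Vector ℚ n) → (∀ x → op co f x ≡ 0ℚ) → ∀ x y → f x ≡ f y
  harmonic⇒constant f harmonic x y = along (connected x y)
    where
    energy≡0 : form co f f ≡ 0ℚ
    energy≡0 = trans (form-op co co-sym f f) (cong₂ _⊕_ f∙≡0 f∙≡0)
      where
      f∙≡0 : f ∙ op co f ≡ 0ℚ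
      f∙≡0 = ∑-zero _ λ x → trans (cong (f x ⊛_) (harmonic x)) (ℚₚ.*-zeroʳ (f x))
    step : ∀ {x y} → Adj G x y → f x ≡ f y
    step {x} {y} xy = ⊖-zero (square-zero (f x ⊖ f y) (begin
      (f x ⊖ f y) ⊛ (f x ⊖ f y)              ≡⟨ ℚₚ.*-identityˡ _ ⟨
      1ℚ ⊛ ((f x ⊖ f y) ⊛ (f x ⊖ f y))       ≡⟨ cong (_⊛ ((f x ⊖ f y) ⊛ (f x ⊖ f y))) (co≡1 xy) ⟨
      co x y ⊛ ((f x ⊖ f y) ⊛ (f x ⊖ f y))   ≡⟨ ∑∑-nonpos⇒zero
        (λ x y → co x y ⊛ ((f x ⊖ f y) ⊛ (f x ⊖ f y)))
        (λ x y → ⊛-nonneg (co-nonneg x y) (square-nonneg (f x ⊖ f y)))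
        (ℚₚ.≤-reflexive energy≡0) x y ⟩
      0ℚ ∎))
      where
      co≡1 : Adj G x y → co x y ≡ 1ℚ
      co≡1 xy with adj F x y | not (does (x ≟ y))
      ... | false | true = refl
    along : ∀ {x y} → Star (Adj G) x y → f x ≡ f y
    along ε          = refl
    along (xz ◅ zys) = trans (step xz) (along zys)

  -- The orthogonal projection onto the kernel of L, that is, the matrix with all entries 1/n. Its
  -- constant rows and unit column sums suffice below.
  N : Matrix n n
  N x y = basis x y ⊖ (L ⊗ X) x y

  -- NL = L - LXL = 0 and L is symmetric, so every row of `N` is harmonic.
  N-row : ∀ i x y → N i x ≡ N i y
  N-row i = harmonic⇒constant (N i) λ x → begin
    op co (N i) x              ≡⟨ L-op (N i) x ⟨
    L x ∙ N i                  ≡⟨ sum-cong-≗ (λ k → solve 3 (λ l b m → l :* (b :- m) := b :* l :- m :* l) refl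
                                    (L x k) (basis i k) ((L ⊗ X) i k)) ⟩
    ∑[ k < n ] (basis i k ⊛ L x k ⊖ (L ⊗ X) i k ⊛ L x k)
                               ≡⟨ ∑-minus (λ k → basis i k ⊛ L x k) (λ k → (L ⊗ X) i k ⊛ L x k) ⟩
    basis i ∙ L x ⊖ (L ⊗ X) i ∙ L x
                               ≡⟨ cong₂ _⊖_ (∑-basis i (L x)) (∙-cong ((L ⊗ X) i) (λ k → L-sym k x)) ⟩
    L x i ⊖ (L ⊗ X ⊗ L) i x    ≡⟨ ⊖-self (trans (L-sym i x) (sym (ABA≋A i x))) ⟩
    0ℚ                         ∎

  ∑-N : ∀ j → ∑[ i < n ] N i j ≡ 1ℚ
  ∑-N j = begin
    ∑[ i < n ] N i j
      ≡⟨ ∑-minus (λ i → basis i j) (λ i → (L ⊗ X) i j) ⟩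
    ∑[ i < n ] basis i j ⊖ ∑[ i < n ] (L ⊗ X) i j
      ≡⟨ cong₂ _⊖_ (trans (sum-cong-≗ λ i → basis-sym i j) (∑-basis-1 j)) (begin
           ∑[ i < n ] ∑[ k < n ] (L i k ⊛ X k j)   ≡⟨ ∑-comm (λ i k → L i k ⊛ X k j) ⟩
           ∑[ k < n ] ∑[ i < n ] (L i k ⊛ X k j)   ≡⟨ ∑-zero _ (λ k → begin
             ∑[ i < n ] (L i k ⊛ X k j)    ≡⟨ *-distribʳ-sum (X k j) (λ i → L i k) ⟨
             ∑[ i < n ] L i k ⊛ X k j      ≡⟨ cong (_⊛ X k j) (∑-L k) ⟩
             0ℚ ⊛ X k j                    ≡⟨ ℚₚ.*-zeroˡ (X k j) ⟩
             0ℚ                            ∎) ⟩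
           0ℚ                                      ∎) ⟩
    1ℚ ⊖ 0ℚ ≡⟨⟩
    1ℚ ∎

  -- Constancy of the rows moves the diagonal of `N` into column `x₀`, whose sum is 1. The vertex
  -- `x₀` also witnesses that n is positive; for n = 0 the formula would fail.
  trace-LX : Fin n → ∑[ i < n ] (L ⊗ X) i i ≡ ι n ⊖ 1ℚ
  trace-LX x₀ = begin
    ∑[ i < n ] (L ⊗ X) i i
      ≡⟨ sum-cong-≗ (λ i → trans
           (solve 2 (λ b m → m := b :- (b :- m)) refl (basis i i) ((L ⊗ X) i i))
           (cong₂ _⊖_ (basis-refl i) (N-row i i x₀))) ⟩
    ∑[ i < n ] (1ℚ ⊖ N i x₀)
      ≡⟨ ∑-minus (λ _ → 1ℚ) (λ i → N i x₀) ⟩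
    ∑[ i < n ] 1ℚ ⊖ ∑[ i < n ] N i x₀
      ≡⟨ cong₂ _⊖_ (∑-1 n) (∑-N x₀) ⟩
    ι n ⊖ 1ℚ ∎

  potential : Fin n → Fin n → Vector ℚ n
  potential x y i = X i x ⊖ X i y

  -- LX = I - N, and the constant rows of `N` annihilate a dipole.
  op-potential : ∀ x y i → op co (potential x y) i ≡ dipole x y i
  op-potential x y i = begin
    op co (potential x y) i          ≡⟨ L-op (potential x y) i ⟨
    L i ∙ potential x y              ≡⟨ sum-cong-≗ (λ k → solve 3 (λ l u v → l :* (u :- v) := l :* u :- l :* v) refl
                                          (L i k) (X k x) (X k y)) ⟩
    ∑[ k < n ] (L i k ⊛ X k x ⊖ L i k ⊛ X k y)
                                     ≡⟨ ∑-minus (λ k → L i k ⊛ X k x) (λ k → L i k ⊛ X k y) ⟩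
    (L ⊗ X) i x ⊖ (L ⊗ X) i y        ≡⟨ solve 4 (λ a b c d → c :- d := (a :- b) :- ((a :- c) :- (b :- d))) refl
                                          (basis i x) (basis i y) ((L ⊗ X) i x) ((L ⊗ X) i y) ⟩
    (basis i x ⊖ basis i y) ⊖ (N i x ⊖ N i y)
                                     ≡⟨ cong₂ _⊖_ (cong₂ _⊖_ (basis-sym i x) (basis-sym i y)) (⊖-self (N-row i x y)) ⟩
    dipole x y i ⊖ 0ℚ                ≡⟨ ℚₚ.+-identityʳ (dipole x y i) ⟩
    dipole x y i                     ∎

  R : Matrix n n
  R = resistance G

  R-potential : ∀ x y → R x y ≡ potential x y ∙ dipole x y
  R-potential x y = sum-cong-≗ λ i → begin
    ∑[ j < n ] (dipole x y i ⊛ X i j ⊛ dipole x y j)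
      ≡⟨ sum-cong-≗ (λ j → solve 3 (λ u v w → u :* v :* w := u :* (w :* v)) refl
           (dipole x y i) (X i j) (dipole x y j)) ⟩
    ∑[ j < n ] (dipole x y i ⊛ (dipole x y j ⊛ X i j))
      ≡⟨ *-distribˡ-sum (dipole x y i) (λ j → dipole x y j ⊛ X i j) ⟨
    dipole x y i ⊛ ∑[ j < n ] (dipole x y j ⊛ X i j)
      ≡⟨ cong (dipole x y i ⊛_) (∑-dipole x y (X i)) ⟩
    dipole x y i ⊛ potential x y i
      ≡⟨ ℚₚ.*-comm (dipole x y i) (potential x y i) ⟩
    potential x y i ⊛ dipole x y i ∎

  -- Grouped by columns of `X`: exchanging `x` and `y` swaps the brackets, and each bracket is a
  -- difference within one column, ready for `L-op` in `foster`.
  R-entries : ∀ x y → R x y ≡ (X x x ⊖ X y x) ⊕ (X y y ⊖ X x y)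
  R-entries x y = begin
    R x y                          ≡⟨ R-potential x y ⟩
    potential x y ∙ dipole x y     ≡⟨ sum-cong-≗ (λ i → ℚₚ.*-comm (potential x y i) (dipole x y i)) ⟩
    dipole x y ∙ potential x y     ≡⟨ ∑-dipole x y (potential x y) ⟩
    (X x x ⊖ X x y) ⊖ (X y x ⊖ X y y)
      ≡⟨ solve 4 (λ a b c d → (a :- b) :- (c :- d) := (a :- c) :+ (d :- b)) refl (X x x) (X x y) (X y x) (X y y) ⟩
    (X x x ⊖ X y x) ⊕ (X y y ⊖ X x y) ∎

  R-sym : R ᵀ ≋ R
  R-sym x y = trans (R-entries y x) (trans (ℚₚ.+-comm (X y y ⊖ X x y) (X x x ⊖ X y x)) (sym (R-entries x y)))

  R-diag : ∀ x → R x x ≡ 0ℚ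
  R-diag x = trans (R-entries x x) (solve 1 (λ a → (a :- a) :+ (a :- a) := con 0ℚ) refl (X x x))

  -- Both brackets of `R-entries` contribute equally by exchange of `x` and `y`. For the first, the
  -- inner sum over `y` is the diagonal entry of LX at `x`, so each half is the trace.
  foster : Fin n → ∑∑ (λ x y → co x y ⊛ R x y) ≡ (ι n ⊖ 1ℚ) ⊕ (ι n ⊖ 1ℚ)
  foster x₀ = begin
    ∑∑ (λ x y → co x y ⊛ R x y)
      ≡⟨ ∑∑-cong (λ x y → trans (cong (co x y ⊛_) (R-entries x y)) (trans
           (ℚₚ.*-distribˡ-+ (co x y) (X x x ⊖ X y x) (X y y ⊖ X x y))
           (cong (λ c → t x y ⊕ c ⊛ (X y y ⊖ X x y)) (co-sym y x)))) ⟩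
    ∑∑ (λ x y → t x y ⊕ t y x)   ≡⟨ ∑∑-plus t (λ x y → t y x) ⟩
    ∑∑ t ⊕ ∑∑ (λ x y → t y x)    ≡⟨ cong (∑∑ t ⊕_) (∑-comm (λ x y → t y x)) ⟩
    ∑∑ t ⊕ ∑∑ t                  ≡⟨ cong₂ _⊕_ ∑∑t ∑∑t ⟩
    (ι n ⊖ 1ℚ) ⊕ (ι n ⊖ 1ℚ)      ∎
    where
    t : Matrix n n
    t x y = co x y ⊛ (X x x ⊖ X y x)
    ∑∑t : ∑∑ t ≡ ι n ⊖ 1ℚ
    ∑∑t = trans (sum-cong-≗ λ x → sym (L-op (λ y → X y x) x)) (trace-LX x₀)

  Kf-double : Fin n → Kf G ⊕ Kf G ≡ ((ι n ⊖ 1ℚ) ⊕ (ι n ⊖ 1ℚ)) ⊕ ∑∑ (λ x y → a x y ⊛ R x y)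
  Kf-double x₀ = begin
    Kf G ⊕ Kf G
      ≡⟨ ∑∑-symmetric R R-sym R-diag ⟨
    ∑∑ R
      ≡⟨ ∑∑-cong (λ x y → solve 2 (λ a r → r := (con 1ℚ :- a) :* r :+ a :* r) refl (a x y) (R x y)) ⟩
    ∑∑ (λ x y → co x y ⊛ R x y ⊕ a x y ⊛ R x y)
      ≡⟨ ∑∑-plus (λ x y → co x y ⊛ R x y) (λ x y → a x y ⊛ R x y) ⟩
    ∑∑ (λ x y → co x y ⊛ R x y) ⊕ ∑∑ (λ x y → a x y ⊛ R x y)
      ≡⟨ cong (_⊕ ∑∑ (λ x y → a x y ⊛ R x y)) (foster x₀) ⟩
    ((ι n ⊖ 1ℚ) ⊕ (ι n ⊖ 1ℚ)) ⊕ ∑∑ (λ x y → a x y ⊛ R x y) ∎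

-- Explicit potentials

-- The adjacency weights of the single edge uv when `u ≢ v`, written as products of basis vectors so
-- that sums collapse by `∑-basis`.
pair : ∀ {n} → Fin n → Fin n → Matrix n n
pair u v x y = basis u x ⊛ basis v y ⊕ basis v x ⊛ basis u y

pair-sym : ∀ {n} (u v : Fin n) → pair u v ᵀ ≋ pair u v
pair-sym u v x y = solve 4 (λ a b c d → a :* b :+ c :* d := d :* c :+ b :* a) refl
  (basis u y) (basis v x) (basis v y) (basis u x)

basis-⊛-01 : ∀ {n} (u v x y : Fin n) →
             (basis u x ⊛ basis v y ≡ 1ℚ × x ≡ u × y ≡ v) ⊎ basis u x ⊛ basis v y ≡ 0ℚ
basis-⊛-01 u v x y with u ≟ x | v ≟ y
... | yes u≡x | yes v≡y = inj₁ (refl , sym u≡x , sym v≡y)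
... | yes _   | no  _   = inj₂ refl
... | no  _   | yes _   = inj₂ refl
... | no  _   | no  _   = inj₂ refl

pair-01 : ∀ {n} {u v : Fin n} → u ≢ v → ∀ x y →
          (pair u v x y ≡ 1ℚ × ((x ≡ u × y ≡ v) ⊎ (x ≡ v × y ≡ u))) ⊎ pair u v x y ≡ 0ℚ
pair-01 {u = u} {v} u≢v x y with basis-⊛-01 u v x y | basis-⊛-01 v u x y
... | inj₁ (eq , refl , refl) | inj₂ eq′          = inj₁ (cong₂ _⊕_ eq eq′ , inj₁ (refl , refl))
... | inj₂ eq                 | inj₁ (eq′ , at)   = inj₁ (cong₂ _⊕_ eq eq′ , inj₂ at)
... | inj₂ eq                 | inj₂ eq′          = inj₂ (cong₂ _⊕_ eq eq′)
... | inj₁ (_ , x≡u , _)      | inj₁ (_ , x≡v , _) = ⊥-elim (u≢v (trans (sym x≡u) x≡v))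

pair-here : ∀ {n} {u v : Fin n} → u ≢ v → pair u v u v ≡ 1ℚ
pair-here {u = u} {v} u≢v = begin
  basis u u ⊛ basis v v ⊕ basis v u ⊛ basis u v
    ≡⟨ cong₂ _⊕_ (cong₂ _⊛_ (basis-refl u) (basis-refl v)) (cong (basis v u ⊛_) (basis-≢ u≢v)) ⟩
  1ℚ ⊕ basis v u ⊛ 0ℚ
    ≡⟨ cong (1ℚ ⊕_) (ℚₚ.*-zeroʳ (basis v u)) ⟩
  1ℚ ∎

pair-there : ∀ {n} {u v : Fin n} → u ≢ v → pair u v v u ≡ 1ℚ
pair-there {u = u} {v} u≢v = trans (pair-sym u v u v) (pair-here u≢v)

∑∑-pair : ∀ {n} (u v : Fin n) → ∑∑ (pair u v) ≡ 2ℚ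
∑∑-pair u v = trans (∑∑-plus (λ x y → basis u x ⊛ basis v y) (λ x y → basis v x ⊛ basis u y))
                    (cong₂ _⊕_ (product u v) (product v u))
  where
  product : ∀ u v → ∑∑ (λ x y → basis u x ⊛ basis v y) ≡ 1ℚ
  product u v = trans (sum-cong-≗ λ x → trans (sym (*-distribˡ-sum (basis u x) (basis v)))
                         (cong (basis u x ⊛_) (∑-basis-1 v)))
                      (∑-basis u (λ _ → 1ℚ))

-- The Laplacian of Kₙ is nI - J, and the all-ones matrix J kills vectors of sum zero.
op-ones : ∀ {n} (w : Vector ℚ n) → sum w ≡ 0ℚ → ∀ x → op (λ _ _ → 1ℚ) w x ≡ ι n ⊛ w x
op-ones {n} w ∑w≡0 x = begin
  ∑[ y < n ] (1ℚ ⊛ (w x ⊖ w y))             ≡⟨ sum-cong-≗ (λ y → solve 2 (λ a b → con 1ℚ :* (a :- b) := con 1ℚ :* a :- b) refl (w x) (w y)) ⟩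
  ∑[ y < n ] (1ℚ ⊛ w x ⊖ w y)               ≡⟨ ∑-minus (λ _ → 1ℚ ⊛ w x) w ⟩
  ∑[ y < n ] (1ℚ ⊛ w x) ⊖ sum w             ≡⟨ cong₂ _⊖_ N*w ∑w≡0 ⟩
  ι n ⊛ w x ⊖ 0ℚ                            ≡⟨ ℚₚ.+-identityʳ (ι n ⊛ w x) ⟩
  ι n ⊛ w x                                 ∎
  where
  N*w : ∑[ y < n ] (1ℚ ⊛ w x) ≡ ι n ⊛ w x
  N*w = begin
    ∑[ y < n ] (1ℚ ⊛ w x)   ≡⟨ *-distribʳ-sum {n} (w x) (λ _ → 1ℚ) ⟨
    ∑[ y < n ] 1ℚ ⊛ w x     ≡⟨ cong (_⊛ w x) (∑-1 n) ⟩
    ι n ⊛ w x               ∎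

-- The Laplacian of one edge is the rank-one matrix formed from its dipole.
op-pair : ∀ {n} (u v : Fin n) w x → op (pair u v) w x ≡ (w u ⊖ w v) ⊛ dipole u v x
op-pair {n} u v w x = begin
  ∑[ y < n ] ((basis u x ⊛ basis v y ⊕ basis v x ⊛ basis u y) ⊛ (w x ⊖ w y))
    ≡⟨ sum-cong-≗ (λ y → solve 5 (λ a b c d e → (a :* b :+ c :* d) :* e := a :* (b :* e) :+ c :* (d :* e)) refl
         (basis u x) (basis v y) (basis v x) (basis u y) (w x ⊖ w y)) ⟩
  ∑[ y < n ] (basis u x ⊛ (basis v y ⊛ (w x ⊖ w y)) ⊕ basis v x ⊛ (basis u y ⊛ (w x ⊖ w y)))
    ≡⟨ ∑-distrib-+ (λ y → basis u x ⊛ (basis v y ⊛ (w x ⊖ w y))) (λ y → basis v x ⊛ (basis u y ⊛ (w x ⊖ w y))) ⟩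
  ∑[ y < n ] (basis u x ⊛ (basis v y ⊛ (w x ⊖ w y))) ⊕ ∑[ y < n ] (basis v x ⊛ (basis u y ⊛ (w x ⊖ w y)))
    ≡⟨ cong₂ _⊕_ (half u v) (half v u) ⟩
  basis u x ⊛ (w u ⊖ w v) ⊕ basis v x ⊛ (w v ⊖ w u)
    ≡⟨ solve 4 (λ a b p q → a :* (p :- q) :+ b :* (q :- p) := (p :- q) :* (a :- b)) refl (basis u x) (basis v x) (w u) (w v) ⟩
  (w u ⊖ w v) ⊛ dipole u v x ∎
  where
  half : ∀ u v → ∑[ y < n ] (basis u x ⊛ (basis v y ⊛ (w x ⊖ w y))) ≡ basis u x ⊛ (w u ⊖ w v)
  half u v = begin
    ∑[ y < n ] (basis u x ⊛ (basis v y ⊛ (w x ⊖ w y)))  ≡⟨ *-distribˡ-sum (basis u x) (λ y → basis v y ⊛ (w x ⊖ w y)) ⟨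
    basis u x ⊛ ∑[ y < n ] (basis v y ⊛ (w x ⊖ w y))    ≡⟨ cong (basis u x ⊛_) (∑-basis v (λ y → w x ⊖ w y)) ⟩
    basis u x ⊛ (w x ⊖ w v)                             ≡⟨ basis-subst (λ x → w x ⊖ w v) u x ⟩
    basis u x ⊛ (w u ⊖ w v)                             ∎

sum-dipole : ∀ {n} (x y : Fin n) → sum (dipole x y) ≡ 0ℚ
sum-dipole x y = trans (∑-minus (basis x) (basis y)) (⊖-self (trans (∑-basis-1 x) (sym (∑-basis-1 y))))

dipole-source : ∀ {n} {x y : Fin n} → x ≢ y → dipole x y x ≡ 1ℚ
dipole-source {x = x} x≢y = cong₂ _⊖_ (basis-refl x) (basis-≢ (≢-sym x≢y))

dipole-sink : ∀ {n} {x y : Fin n} → x ≢ y → dipole x y y ≡ 0ℚ ⊖ 1ℚ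
dipole-sink {y = y} x≢y = cong₂ _⊖_ (basis-≢ x≢y) (basis-refl y)

dipole-outside : ∀ {n} {x y i : Fin n} → x ≢ i → y ≢ i → dipole x y i ≡ 0ℚ
dipole-outside x≢i y≢i = cong₂ _⊖_ (basis-≢ x≢i) (basis-≢ y≢i)

Adj-sym : ∀ {n} (G : SimpleGraph (Fin n)) {x y} → Adj G x y → Adj G y x
Adj-sym G {x} {y} = subst T (adj-sym G x y)

Adj⇒≢ : ∀ {n} (G : SimpleGraph (Fin n)) {x y} → Adj G x y → x ≢ y
Adj⇒≢ G {x} xy refl = subst T (adj-irrefl G x) xy

Adj⇒adjacency : ∀ {n} (G : SimpleGraph (Fin n)) {x y} → Adj G x y → adjacency G x y ≡ 1ℚ
Adj⇒adjacency G {x} {y} xy with adjacency-01 G x y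
... | inj₁ (_ , eq) = eq
... | inj₂ (¬xy , _) = ⊥-elim (¬xy xy)

-- Rayleigh's principle and the resistance of a single deleted edge

module Resistance {n} (F : EdgeSet n) (connected : Connected (K n ∖ F)) where

  open Foster F connected

  -- Rayleigh's principle: w is the potential for Kₙ − h, and deleting the
  -- remaining edges of F from that graph can only raise the resistance.
  module Subgraph (h : Matrix n n) (h-sym : h ᵀ ≋ h)
                  (h-01 : ∀ i j → (h i j ≡ 1ℚ × Adj F i j) ⊎ h i j ≡ 0ℚ)
                  (w : Vector ℚ n) (x y : Fin n)
                  (w-potential : ∀ i → op (λ i j → 1ℚ ⊖ h i j) w i ≡ dipole x y i) where

    d : Matrix n n
    d i j = a i j ⊖ h i j

    d-nonneg : ∀ i j → 0ℚ ℚ.≤ d i j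
    d-nonneg i j with h-01 i j | adjacency-01 F i j
    ... | inj₁ (h≡1 , ij) | _              = ℚₚ.≤-reflexive (sym (⊖-self (trans (Adj⇒adjacency F ij) (sym h≡1))))
    ... | inj₂ h≡0        | inj₁ (_ , a≡1) = subst (0ℚ ℚ.≤_) (sym (cong₂ _⊖_ a≡1 h≡0)) (ℚₚ.nonNegative⁻¹ 1ℚ)
    ... | inj₂ h≡0        | inj₂ (_ , a≡0) = ℚₚ.≤-reflexive (sym (cong₂ _⊖_ a≡0 h≡0))

    open Dirichlet (λ i j → 1ℚ ⊖ h i j) d (λ i j → cong (1ℚ ⊖_) (h-sym i j))
      (λ i j → cong₂ _⊖_ (adjacency-sym F i j) (h-sym i j))
      (dipole x y) (potential x y) w co
      (λ i j → solve 2 (λ a h → con 1ℚ :- a := (con 1ℚ :- h) :- (a :- h)) refl (a i j) (h i j))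
      (op-potential x y) w-potential

    w∙dipole : w ∙ dipole x y ≡ w x ⊖ w y
    w∙dipole = trans (sum-cong-≗ λ i → ℚₚ.*-comm (w i) (dipole x y i)) (∑-dipole x y w)

    form≥0 : 0ℚ ℚ.≤ form d w w
    form≥0 = form-nonneg d d-nonneg w

    lower-double : ((w x ⊖ w y) ⊕ (w x ⊖ w y)) ⊕ form d w w ℚ.≤ R x y ⊕ R x y
    lower-double = subst₂ (λ u v → (u ⊕ u) ⊕ form d w w ℚ.≤ v ⊕ v) w∙dipole (sym (R-potential x y))
      (lower co-nonneg)

    resistance-≥ : w x ⊖ w y ℚ.≤ R x y
    resistance-≥ = ≤-double (ℚₚ.≤-trans
      (subst (ℚ._≤ ((w x ⊖ w y) ⊕ (w x ⊖ w y)) ⊕ form d w w) (ℚₚ.+-identityʳ _)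
        (ℚₚ.+-monoʳ-≤ ((w x ⊖ w y) ⊕ (w x ⊖ w y)) form≥0))
      lower-double)

    -- Equality leaves no room for `form d w w` in `lower-double`, and that form is a sum of
    -- non-negative terms.
    tight⇒zero : R x y ≡ w x ⊖ w y → ∀ i j → d i j ⊛ ((w i ⊖ w j) ⊛ (w i ⊖ w j)) ≡ 0ℚ
    tight⇒zero R≡ = ∑∑-nonpos⇒zero (λ i j → d i j ⊛ ((w i ⊖ w j) ⊛ (w i ⊖ w j)))
      (λ i j → ⊛-nonneg (d-nonneg i j) (square-nonneg (w i ⊖ w j)))
      (subst₂ ℚ._≤_ (solve 2 (λ s f → (:- s) :+ (s :+ f) := f) refl s (form d w w)) (ℚₚ.+-inverseˡ s)
        (ℚₚ.+-monoʳ-≤ (ℚ.- s) (subst (λ r → s ⊕ form d w w ℚ.≤ r ⊕ r) R≡ lower-double)))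
      where
      s : ℚ
      s = (w x ⊖ w y) ⊕ (w x ⊖ w y)

    -- Deleting an edge between equal potentials does not disturb `w`, so the comparison with Kₙ - h
    -- becomes exact.
    resistance-≡ : (∀ i j → Adj F i j → h i j ≡ 1ℚ ⊎ w i ≡ w j) → R x y ≡ w x ⊖ w y
    resistance-≡ closed = trans (R-potential x y) (trans (exact dw≡0) w∙dipole)
      where
      dw≡0 : ∀ i j → d i j ⊛ (w i ⊖ w j) ≡ 0ℚ
      d≡0⇒ : ∀ i j → d i j ≡ 0ℚ → d i j ⊛ (w i ⊖ w j) ≡ 0ℚ
      d≡0⇒ i j d≡0 = trans (cong (_⊛ (w i ⊖ w j)) d≡0) (ℚₚ.*-zeroˡ (w i ⊖ w j))
      dw≡0 i j with adjacency-01 F i j | h-01 i j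
      ... | inj₂ (¬ij , _)  | inj₁ (_ , ij) = ⊥-elim (¬ij ij)
      ... | inj₂ (_ , a≡0)  | inj₂ h≡0      = d≡0⇒ i j (cong₂ _⊖_ a≡0 h≡0)
      ... | inj₁ (ij , a≡1) | _ with closed i j ij
      ...   | inj₁ h≡1   = d≡0⇒ i j (cong₂ _⊖_ a≡1 h≡1)
      ...   | inj₂ wi≡wj = trans (cong (d i j ⊛_) (⊖-self wi≡wj)) (ℚₚ.*-zeroʳ (d i j))

  -- In Kₙ - xy the dipole is an eigenvector with eigenvalue n - 2: n from Kₙ less 2 from the
  -- deleted edge. The potential is thus `c` times the dipole with c = 1/(n - 2), and its drop is
  -- 2/(n - 2).
  module Edge (c : ℚ) (c-inv : c ⊛ (ι n ⊖ 2ℚ) ≡ 1ℚ) {x y} (xy : Adj F x y) where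

    x≢y : x ≢ y
    x≢y = Adj⇒≢ F xy

    w : Vector ℚ n
    w i = c ⊛ dipole x y i

    wx : w x ≡ c
    wx = trans (cong (c ⊛_) (dipole-source x≢y)) (ℚₚ.*-identityʳ c)

    wy : w y ≡ 0ℚ ⊖ c
    wy = trans (cong (c ⊛_) (dipole-sink x≢y)) (solve 1 (λ c → c :* (con 0ℚ :- con 1ℚ) := con 0ℚ :- c) refl c)

    wi : ∀ {i} → x ≢ i → y ≢ i → w i ≡ 0ℚ
    wi x≢i y≢i = trans (cong (c ⊛_) (dipole-outside x≢i y≢i)) (ℚₚ.*-zeroʳ c)

    drop : w x ⊖ w y ≡ c ⊕ c
    drop = trans (cong₂ _⊖_ wx wy) (solve 1 (λ c → c :- (con 0ℚ :- c) := c :+ c) refl c)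

    w-potential : ∀ i → op (λ i j → 1ℚ ⊖ pair x y i j) w i ≡ dipole x y i
    w-potential i = begin
      op (λ i j → 1ℚ ⊖ pair x y i j) w i
        ≡⟨ op-minusʷ (λ _ _ → 1ℚ) (pair x y) w i ⟩
      op (λ _ _ → 1ℚ) w i ⊖ op (pair x y) w i
        ≡⟨ cong₂ _⊖_ (op-ones w ∑w≡0 i) (trans (op-pair x y w i) (cong (_⊛ dipole x y i) drop)) ⟩
      ι n ⊛ (c ⊛ dipole x y i) ⊖ (c ⊕ c) ⊛ dipole x y i
        ≡⟨ solve 3 (λ N c δ → N :* (c :* δ) :- (c :+ c) :* δ := c :* (N :- con 2ℚ) :* δ) refl (ι n) c (dipole x y i) ⟩
      c ⊛ (ι n ⊖ 2ℚ) ⊛ dipole x y i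
        ≡⟨ trans (cong (_⊛ dipole x y i) c-inv) (ℚₚ.*-identityˡ (dipole x y i)) ⟩
      dipole x y i ∎
      where
      ∑w≡0 : sum w ≡ 0ℚ
      ∑w≡0 = trans (sym (*-distribˡ-sum c (dipole x y))) (trans (cong (c ⊛_) (sum-dipole x y)) (ℚₚ.*-zeroʳ c))

    h-01 : ∀ i j → (pair x y i j ≡ 1ℚ × Adj F i j) ⊎ pair x y i j ≡ 0ℚ
    h-01 i j with pair-01 x≢y i j
    ... | inj₁ (eq , inj₁ (refl , refl)) = inj₁ (eq , xy)
    ... | inj₁ (eq , inj₂ (refl , refl)) = inj₁ (eq , Adj-sym F xy)
    ... | inj₂ eq                        = inj₂ eq

    open Subgraph (pair x y) (pair-sym x y) h-01 w x y w-potential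

    edge-≥ : c ⊕ c ℚ.≤ R x y
    edge-≥ = subst (ℚ._≤ R x y) drop resistance-≥

    -- The test potential falls from `c` at `x` to 0 at `z`, so the further deleted edge xz carries
    -- positive energy and tightness is impossible.
    edge-≢ : ∀ {z} → Adj F x z → y ≢ z → R x y ≢ c ⊕ c
    edge-≢ {z} xz y≢z R≡ = c≢0 (square-zero c (begin
      c ⊛ c                                       ≡⟨ solve 1 (λ c → c :* c := (con 1ℚ :- con 0ℚ) :* ((c :- con 0ℚ) :* (c :- con 0ℚ))) refl c ⟩
      (1ℚ ⊖ 0ℚ) ⊛ ((c ⊖ 0ℚ) ⊛ (c ⊖ 0ℚ))           ≡⟨ cong₂ (λ u v → u ⊛ (v ⊛ v)) (cong₂ _⊖_ (Adj⇒adjacency F xz) pair≡0)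
                                                       (cong₂ _⊖_ wx (wi (Adj⇒≢ F xz) y≢z)) ⟨
      d x z ⊛ ((w x ⊖ w z) ⊛ (w x ⊖ w z))         ≡⟨ tight⇒zero (trans R≡ (sym drop)) x z ⟩
      0ℚ                                          ∎))
      where
      pair≡0 : pair x y x z ≡ 0ℚ
      pair≡0 with pair-01 x≢y x z
      ... | inj₁ (_ , inj₁ (_ , z≡y)) = ⊥-elim (y≢z (sym z≡y))
      ... | inj₁ (_ , inj₂ (x≡y , _)) = ⊥-elim (x≢y x≡y)
      ... | inj₂ eq = eq
      c≢0 : c ≢ 0ℚ
      c≢0 c≡0 with trans (sym c-inv) (trans (cong (_⊛ (ι n ⊖ 2ℚ)) c≡0) (ℚₚ.*-zeroˡ (ι n ⊖ 2ℚ)))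
      ... | ()

    -- For an isolated edge of F, `w` vanishes at both ends of every other edge of F.
    edge-≡ : (∀ {z} → Adj F x z → z ≡ y) → (∀ {z} → Adj F y z → z ≡ x) → R x y ≡ c ⊕ c
    edge-≡ only-y only-x = trans (resistance-≡ closed) drop
      where
      closed : ∀ i j → Adj F i j → pair x y i j ≡ 1ℚ ⊎ w i ≡ w j
      closed i j ij with i ≟ x | i ≟ y | j ≟ x | j ≟ y
      ... | yes refl | _ | _ | _ = inj₁ (subst (λ j → pair x y x j ≡ 1ℚ) (sym (only-y ij)) (pair-here x≢y))
      ... | no _ | yes refl | _ | _ = inj₁ (subst (λ j → pair x y y j ≡ 1ℚ) (sym (only-x ij)) (pair-there x≢y))
      ... | no _ | no i≢y | yes refl | _ = ⊥-elim (i≢y (only-y (Adj-sym F ij)))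
      ... | no i≢x | no _ | no _ | yes refl = ⊥-elim (i≢x (only-x (Adj-sym F ij)))
      ... | no i≢x | no i≢y | no j≢x | no j≢y =
            inj₂ (trans (wi (≢-sym i≢x) (≢-sym i≢y)) (sym (wi (≢-sym j≢x) (≢-sym j≢y))))

-- The resistance of an edge in a deleted path on three vertices

3ℚ : ℚ
3ℚ = 1ℚ ⊕ 2ℚ

cherry : ∀ {n} → Fin n → Fin n → Fin n → Matrix n n
cherry u v t x y = pair u v x y ⊕ pair u t x y

Leg : ∀ {n} → Fin n → Fin n → Fin n → Fin n → Fin n → Set
Leg u v t x y = ((x ≡ u × y ≡ v) ⊎ (x ≡ v × y ≡ u)) ⊎ ((x ≡ u × y ≡ t) ⊎ (x ≡ t × y ≡ u))

cherry-sym : ∀ {n} (u v t : Fin n) → cherry u v t ᵀ ≋ cherry u v t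
cherry-sym u v t x y = cong₂ _⊕_ (pair-sym u v x y) (pair-sym u t x y)

cherry-01 : ∀ {n} {u v t : Fin n} → u ≢ v → u ≢ t → v ≢ t → ∀ x y →
            (cherry u v t x y ≡ 1ℚ × Leg u v t x y) ⊎ cherry u v t x y ≡ 0ℚ
cherry-01 u≢v u≢t v≢t x y with pair-01 u≢v x y | pair-01 u≢t x y
... | inj₁ (eq , at) | inj₂ eq′        = inj₁ (cong₂ _⊕_ eq eq′ , inj₁ at)
... | inj₂ eq        | inj₁ (eq′ , at) = inj₁ (cong₂ _⊕_ eq eq′ , inj₂ at)
... | inj₂ eq        | inj₂ eq′        = inj₂ (cong₂ _⊕_ eq eq′)
... | inj₁ (_ , inj₁ (_ , y≡v))    | inj₁ (_ , inj₁ (_ , y≡t))   = ⊥-elim (v≢t (trans (sym y≡v) y≡t))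
... | inj₁ (_ , inj₁ (x≡u , _))    | inj₁ (_ , inj₂ (x≡t , _))   = ⊥-elim (u≢t (trans (sym x≡u) x≡t))
... | inj₁ (_ , inj₂ (x≡v , _))    | inj₁ (_ , inj₁ (x≡u , _))   = ⊥-elim (u≢v (trans (sym x≡u) x≡v))
... | inj₁ (_ , inj₂ (x≡v , _))    | inj₁ (_ , inj₂ (x≡t , _))   = ⊥-elim (v≢t (trans (sym x≡v) x≡t))

pair-at : ∀ {n} {u v : Fin n} → u ≢ v → ∀ {x y} → (x ≡ u × y ≡ v) ⊎ (x ≡ v × y ≡ u) → pair u v x y ≡ 1ℚ
pair-at u≢v (inj₁ (refl , refl)) = pair-here u≢v
pair-at u≢v (inj₂ (refl , refl)) = pair-there u≢v

1≢0 : 1ℚ ≢ 0ℚ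
1≢0 ()

2≢0 : 2ℚ ≢ 0ℚ
2≢0 ()

cherry-at : ∀ {n} {u v t : Fin n} → u ≢ v → u ≢ t → v ≢ t → ∀ {x y} →
            Leg u v t x y → cherry u v t x y ≡ 1ℚ
cherry-at u≢v u≢t v≢t {x} {y} leg with cherry-01 u≢v u≢t v≢t x y
... | inj₁ (eq , _) = eq
-- On a leg one summand is 1 and the other 0 or 1, so the entry is 1 or 2 and cannot be 0.
... | inj₂ eq with leg | pair-01 u≢v x y | pair-01 u≢t x y
...   | inj₁ at | _             | inj₁ (q , _) = ⊥-elim (2≢0 (trans (sym (cong₂ _⊕_ (pair-at u≢v at) q)) eq))
...   | inj₁ at | _             | inj₂ q       = ⊥-elim (1≢0 (trans (sym (cong₂ _⊕_ (pair-at u≢v at) q)) eq))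
...   | inj₂ at | inj₁ (p , _)  | _            = ⊥-elim (2≢0 (trans (sym (cong₂ _⊕_ p (pair-at u≢t at))) eq))
...   | inj₂ at | inj₂ p        | _            = ⊥-elim (1≢0 (trans (sym (cong₂ _⊕_ p (pair-at u≢t at))) eq))

-- With the centre u given, the conditions say that every other edge is
-- disjoint from all remaining ones.
record IsCherry {n} (F : EdgeSet n) (u v t : Fin n) : Set where
  field
    v≢t    : v ≢ t
    uv     : Adj F u v
    ut     : Adj F u t
    centre : ∀ {z} → Adj F u z → z ≡ v ⊎ z ≡ t
    other  : ∀ {x y z} → x ≢ u → Adj F x y → Adj F x z → y ≡ z

module CherryResistance {n} (F : EdgeSet n) (connected : Connected (K n ∖ F))
                        (γ : ℚ) (γ-inv : γ ⊛ ((ι n ⊖ 1ℚ) ⊛ (ι n ⊖ 3ℚ)) ≡ 1ℚ) where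

  open Foster F connected using (R)

  private
    N : ℚ
    N = ι n

  legR : ℚ
  legR = γ ⊛ (N ⊕ N ⊖ 3ℚ)

  module Legs {u v t} (uv : Adj F u v) (ut : Adj F u t) (v≢t : v ≢ t) where

    u≢v : u ≢ v
    u≢v = Adj⇒≢ F uv

    u≢t : u ≢ t
    u≢t = Adj⇒≢ F ut

    -- Write p and q for the dipoles of uv and ut; their inner products are p·p = q·q = 2 and p·q =
    -- 1. On αp + βq the Laplacian of Kₙ minus both edges has coefficients (n - 2)α - β and (n - 2)β
    -- - α. Requiring 1 and 0 gives α = (n - 2)β and β = 1/((n - 1)(n - 3)), which is `γ`.
    w : Vector ℚ n
    w i = γ ⊛ ((N ⊖ 2ℚ) ⊛ dipole u v i ⊕ dipole u t i)

    w-value : ∀ {i p q} → dipole u v i ≡ p → dipole u t i ≡ q → w i ≡ γ ⊛ ((N ⊖ 2ℚ) ⊛ p ⊕ q)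
    w-value eq eq′ = cong₂ (λ p q → γ ⊛ ((N ⊖ 2ℚ) ⊛ p ⊕ q)) eq eq′

    wu : w u ≡ γ ⊛ ((N ⊖ 2ℚ) ⊛ 1ℚ ⊕ 1ℚ)
    wu = w-value (dipole-source u≢v) (dipole-source u≢t)

    wv : w v ≡ γ ⊛ ((N ⊖ 2ℚ) ⊛ (0ℚ ⊖ 1ℚ) ⊕ 0ℚ)
    wv = w-value (dipole-sink u≢v) (dipole-outside u≢v (≢-sym v≢t))

    wt : w t ≡ γ ⊛ ((N ⊖ 2ℚ) ⊛ 0ℚ ⊕ (0ℚ ⊖ 1ℚ))
    wt = w-value (dipole-outside u≢t v≢t) (dipole-sink u≢t)

    w-outside : ∀ {i} → u ≢ i → v ≢ i → t ≢ i → w i ≡ 0ℚ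
    w-outside u≢i v≢i t≢i = trans (w-value (dipole-outside u≢i v≢i) (dipole-outside u≢i t≢i))
      (solve 2 (λ γ N → γ :* ((N :- con 2ℚ) :* con 0ℚ :+ con 0ℚ) := con 0ℚ) refl γ N)

    drop : w u ⊖ w v ≡ legR
    drop = trans (cong₂ _⊖_ wu wv)
      (solve 2 (λ γ N → γ :* ((N :- con 2ℚ) :* con 1ℚ :+ con 1ℚ) :- γ :* ((N :- con 2ℚ) :* (con 0ℚ :- con 1ℚ) :+ con 0ℚ)
                        := γ :* (N :+ N :- con 3ℚ)) refl γ N)

    -- The current still runs from `u` to `v`: this is the voltage across the other leg, needed for
    -- `op-cherry`, and not the resistance of ut.
    drop′ : w u ⊖ w t ≡ γ ⊛ N
    drop′ = trans (cong₂ _⊖_ wu wt)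
      (solve 2 (λ γ N → γ :* ((N :- con 2ℚ) :* con 1ℚ :+ con 1ℚ) :- γ :* ((N :- con 2ℚ) :* con 0ℚ :+ (con 0ℚ :- con 1ℚ))
                        := γ :* N) refl γ N)

    sum-w : sum w ≡ 0ℚ
    sum-w = begin
      sum w
        ≡⟨ *-distribˡ-sum γ (λ i → (N ⊖ 2ℚ) ⊛ dipole u v i ⊕ dipole u t i) ⟨
      γ ⊛ ∑[ i < n ] ((N ⊖ 2ℚ) ⊛ dipole u v i ⊕ dipole u t i)
        ≡⟨ cong (γ ⊛_) (∑-distrib-+ (λ i → (N ⊖ 2ℚ) ⊛ dipole u v i) (dipole u t)) ⟩
      γ ⊛ (∑[ i < n ] ((N ⊖ 2ℚ) ⊛ dipole u v i) ⊕ sum (dipole u t))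
        ≡⟨ cong₂ (λ p q → γ ⊛ (p ⊕ q))
             (trans (sym (*-distribˡ-sum (N ⊖ 2ℚ) (dipole u v))) (cong ((N ⊖ 2ℚ) ⊛_) (sum-dipole u v)))
             (sum-dipole u t) ⟩
      γ ⊛ ((N ⊖ 2ℚ) ⊛ 0ℚ ⊕ 0ℚ)
        ≡⟨ solve 2 (λ γ N → γ :* ((N :- con 2ℚ) :* con 0ℚ :+ con 0ℚ) := con 0ℚ) refl γ N ⟩
      0ℚ ∎

    op-cherry : ∀ i → op (cherry u v t) w i ≡ legR ⊛ dipole u v i ⊕ γ ⊛ N ⊛ dipole u t i
    op-cherry i = begin
      op (cherry u v t) w i
        ≡⟨ sum-cong-≗ (λ j → ℚₚ.*-distribʳ-+ (w i ⊖ w j) (pair u v i j) (pair u t i j)) ⟩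
      ∑[ j < n ] (pair u v i j ⊛ (w i ⊖ w j) ⊕ pair u t i j ⊛ (w i ⊖ w j))
        ≡⟨ ∑-distrib-+ (λ j → pair u v i j ⊛ (w i ⊖ w j)) (λ j → pair u t i j ⊛ (w i ⊖ w j)) ⟩
      op (pair u v) w i ⊕ op (pair u t) w i
        ≡⟨ cong₂ _⊕_ (trans (op-pair u v w i) (cong (_⊛ dipole u v i) drop))
                     (trans (op-pair u t w i) (cong (_⊛ dipole u t i) drop′)) ⟩
      legR ⊛ dipole u v i ⊕ γ ⊛ N ⊛ dipole u t i ∎

    w-potential : ∀ i → op (λ i j → 1ℚ ⊖ cherry u v t i j) w i ≡ dipole u v i
    w-potential i = begin
      op (λ i j → 1ℚ ⊖ cherry u v t i j) w i
        ≡⟨ op-minusʷ (λ _ _ → 1ℚ) (cherry u v t) w i ⟩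
      op (λ _ _ → 1ℚ) w i ⊖ op (cherry u v t) w i
        ≡⟨ cong₂ _⊖_ (op-ones w sum-w i) (op-cherry i) ⟩
      N ⊛ w i ⊖ (legR ⊛ dipole u v i ⊕ γ ⊛ N ⊛ dipole u t i)
        ≡⟨ solve 4 (λ γ N p q → N :* (γ :* ((N :- con 2ℚ) :* p :+ q)) :- (γ :* (N :+ N :- con 3ℚ) :* p :+ γ :* N :* q)
                    := γ :* ((N :- con 1ℚ) :* (N :- con 3ℚ)) :* p) refl γ N (dipole u v i) (dipole u t i) ⟩
      γ ⊛ ((N ⊖ 1ℚ) ⊛ (N ⊖ 3ℚ)) ⊛ dipole u v i
        ≡⟨ trans (cong (_⊛ dipole u v i) γ-inv) (ℚₚ.*-identityˡ (dipole u v i)) ⟩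
      dipole u v i ∎

    h-01 : ∀ i j → (cherry u v t i j ≡ 1ℚ × Adj F i j) ⊎ cherry u v t i j ≡ 0ℚ
    h-01 i j with cherry-01 u≢v u≢t v≢t i j
    ... | inj₁ (eq , inj₁ (inj₁ (refl , refl))) = inj₁ (eq , uv)
    ... | inj₁ (eq , inj₁ (inj₂ (refl , refl))) = inj₁ (eq , Adj-sym F uv)
    ... | inj₁ (eq , inj₂ (inj₁ (refl , refl))) = inj₁ (eq , ut)
    ... | inj₁ (eq , inj₂ (inj₂ (refl , refl))) = inj₁ (eq , Adj-sym F ut)
    ... | inj₂ eq                               = inj₂ eq

    open Resistance.Subgraph F connected (cherry u v t) (cherry-sym u v t) h-01 w u v w-potential

    leg-≥ : legR ℚ.≤ R u v
    leg-≥ = subst (ℚ._≤ R u v) drop resistance-≥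

    -- The potential is supported on `u`, `v` and `t`, and under `IsCherry` an edge of F meeting
    -- these vertices is a leg. All remaining edges join zeros of `w`.
    leg-≡ : IsCherry F u v t → R u v ≡ legR
    leg-≡ isCherry = trans (resistance-≡ closed) drop
      where
      open IsCherry isCherry using (centre; other)

      ends : ∀ {i j} → Adj F i j → i ≡ u ⊎ i ≡ v ⊎ i ≡ t → Leg u v t i j
      ends ij (inj₁ refl) with centre ij
      ... | inj₁ j≡v = inj₁ (inj₁ (refl , j≡v))
      ... | inj₂ j≡t = inj₂ (inj₁ (refl , j≡t))
      ends ij (inj₂ (inj₁ refl)) = inj₁ (inj₂ (refl , other (≢-sym u≢v) ij (Adj-sym F uv)))
      ends ij (inj₂ (inj₂ refl)) = inj₂ (inj₂ (refl , other (≢-sym u≢t) ij (Adj-sym F ut)))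

      supp : ∀ i → (i ≡ u ⊎ i ≡ v ⊎ i ≡ t) ⊎ w i ≡ 0ℚ
      supp i with i ≟ u | i ≟ v | i ≟ t
      ... | yes i≡u | _       | _       = inj₁ (inj₁ i≡u)
      ... | no  _   | yes i≡v | _       = inj₁ (inj₂ (inj₁ i≡v))
      ... | no  _   | no  _   | yes i≡t = inj₁ (inj₂ (inj₂ i≡t))
      ... | no  i≢u | no  i≢v | no  i≢t = inj₂ (w-outside (≢-sym i≢u) (≢-sym i≢v) (≢-sym i≢t))

      closed : ∀ i j → Adj F i j → cherry u v t i j ≡ 1ℚ ⊎ w i ≡ w j
      closed i j ij with supp i | supp j
      ... | inj₁ i∈ | _       = inj₁ (cherry-at u≢v u≢t v≢t (ends ij i∈))
      ... | inj₂ _  | inj₁ j∈ = inj₁ (trans (cherry-sym u v t j i)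
                                  (cherry-at u≢v u≢t v≢t (ends (Adj-sym F ij) j∈)))
      ... | inj₂ wi≡0 | inj₂ wj≡0 = inj₂ (trans wi≡0 (sym wj≡0))

-- Edge counting and the slack of the bound

ι-+ : ∀ k l → ι (k ℕ.+ l) ≡ ι k ⊕ ι l
ι-+ zero    l = sym (ℚₚ.+-identityˡ (ι l))
ι-+ (suc k) l = trans (cong (1ℚ ⊕_) (ι-+ k l)) (sym (ℚₚ.+-assoc 1ℚ (ι k) (ι l)))

ι-sum : ∀ {n} (f : Fin n → ℕ) → ι (sumℕ f) ≡ ∑[ i < n ] ι (f i)
ι-sum {zero}  f = refl
ι-sum {suc n} f = trans (ι-+ (f zero) (sumℕ λ i → f (suc i))) (cong (ι (f zero) ⊕_) (ι-sum (λ i → f (suc i))))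

∑∑-adjacency : ∀ {n} (F : EdgeSet n) → ∑∑ (adjacency F) ≡ ι (size F) ⊕ ι (size F)
∑∑-adjacency {n} F = trans
  (∑∑-symmetric (adjacency F) (adjacency-sym F) (λ x → cong (if_then 1ℚ else 0ℚ) (adj-irrefl F x)))
  (cong₂ _⊕_ half half)
  where
  count : Fin n → Fin n → ℕ
  count x y = if does (x <? y) ∧ adj F x y then 1 else 0
  ι-count : ∀ b b′ → (if b then (if b′ then 1ℚ else 0ℚ) else 0ℚ) ≡ ι (if b ∧ b′ then 1 else 0)
  ι-count false _     = refl
  ι-count true  false = refl
  ι-count true  true  = refl
  half : ∑∑ (λ x y → if does (x <? y) then adjacency F x y else 0ℚ) ≡ ι (size F)
  half = trans (∑∑-cong λ x y → ι-count (does (x <? y)) (adj F x y))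
    (sym (trans (ι-sum (λ x → sumℕ (count x))) (sum-cong-≗ λ x → ι-sum (count x))))

IsCherry-swap : ∀ {n} {F : EdgeSet n} {u v t} → IsCherry F u v t → IsCherry F u t v
IsCherry-swap isCherry = record
  { v≢t = ≢-sym v≢t ; uv = ut ; ut = uv
  ; centre = λ uz → swap (centre uz) ; other = other }
  where open IsCherry isCherry

-- Each of the p edges is charged `c ⊕ c`, and the two legs are charged in addition their surplus
-- over it. Here c and γ stand for 1/(n - 2) and 1/((n - 1)(n - 3)).
kirchhoffBound : ℕ → ℚ → ℚ → ℕ → ℚ
kirchhoffBound n c γ p = (ι n ⊖ 1ℚ) ⊕ (c ⊕ c) ⊛ ι p ⊕ 2ℚ ⊛ (γ ⊛ (ι n ⊕ ι n ⊖ 3ℚ) ⊖ (c ⊕ c))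

module KirchhoffBound {n} (F : EdgeSet n) (connected : Connected (K n ∖ F))
                      (c : ℚ) (c-inv : c ⊛ (ι n ⊖ 2ℚ) ≡ 1ℚ)
                      (γ : ℚ) (γ-inv : γ ⊛ ((ι n ⊖ 1ℚ) ⊛ (ι n ⊖ 3ℚ)) ≡ 1ℚ)
                      {u v t} (uv : Adj F u v) (ut : Adj F u t) (v≢t : v ≢ t) where

  open Foster F connected using (a; R; R-sym; Kf-double)
  open CherryResistance F connected γ γ-inv using (legR; module Legs)
  open Legs uv ut v≢t using (u≢v; u≢t; h-01)

  edgeR : ℚ
  edgeR = c ⊕ c

  -- What the resistance of a deleted edge exceeds its charge by: `legR` on the two legs, `edgeR` on
  -- other edges of F, and nothing off F.
  slack : Matrix n n
  slack x y = a x y ⊛ R x y ⊖ (edgeR ⊛ a x y ⊕ (legR ⊖ edgeR) ⊛ cherry u v t x y)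

  data Case (x y : Fin n) : Set where
    nonadjacent : ¬ Adj F x y → slack x y ≡ 0ℚ → Case x y
    other-edge  : Adj F x y → ¬ Leg u v t x y → slack x y ≡ R x y ⊖ edgeR → Case x y
    leg         : Leg u v t x y → slack x y ≡ R x y ⊖ legR → Case x y

  slack-value : ∀ {x y p q} → a x y ≡ p → cherry u v t x y ≡ q →
                slack x y ≡ p ⊛ R x y ⊖ (edgeR ⊛ p ⊕ (legR ⊖ edgeR) ⊛ q)
  slack-value {x} {y} = cong₂ λ p q → p ⊛ R x y ⊖ (edgeR ⊛ p ⊕ (legR ⊖ edgeR) ⊛ q)

  classify : ∀ x y → Case x y
  classify x y with adjacency-01 F x y | cherry-01 u≢v u≢t v≢t x y | h-01 x y
  ... | inj₂ (¬xy , a≡0) | _ | inj₁ (_ , xy) = ⊥-elim (¬xy xy)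
  ... | inj₂ (¬xy , a≡0) | _ | inj₂ h≡0 = nonadjacent ¬xy (trans (slack-value a≡0 h≡0)
        (solve 3 (λ R r l → con 0ℚ :* R :- (r :* con 0ℚ :+ (l :- r) :* con 0ℚ) := con 0ℚ) refl (R x y) edgeR legR))
  ... | inj₁ (xy , a≡1) | inj₁ (h≡1 , at) | _ = leg at (trans (slack-value a≡1 h≡1)
        (solve 3 (λ R r l → con 1ℚ :* R :- (r :* con 1ℚ :+ (l :- r) :* con 1ℚ) := R :- l) refl (R x y) edgeR legR))
  ... | inj₁ (xy , a≡1) | inj₂ h≡0 | _ = other-edge xy
        (λ at → 1≢0 (trans (sym (cherry-at u≢v u≢t v≢t at)) h≡0))
        (trans (slack-value a≡1 h≡0)
          (solve 3 (λ R r l → con 1ℚ :* R :- (r :* con 1ℚ :+ (l :- r) :* con 0ℚ) := R :- r) refl (R x y) edgeR legR))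

  -- `Legs` treats the ordered pair (u, v). Symmetry of `R` reverses a leg, and exchanging `v` with
  -- `t` passes to the other leg.
  leg-≥ : ∀ {x y} → Leg u v t x y → legR ℚ.≤ R x y
  leg-≥ (inj₁ (inj₁ (refl , refl))) = Legs.leg-≥ uv ut v≢t
  leg-≥ (inj₁ (inj₂ (refl , refl))) = subst (legR ℚ.≤_) (R-sym v u) (Legs.leg-≥ uv ut v≢t)
  leg-≥ (inj₂ (inj₁ (refl , refl))) = Legs.leg-≥ ut uv (≢-sym v≢t)
  leg-≥ (inj₂ (inj₂ (refl , refl))) = subst (legR ℚ.≤_) (R-sym t u) (Legs.leg-≥ ut uv (≢-sym v≢t))

  leg-≡ : IsCherry F u v t → ∀ {x y} → Leg u v t x y → R x y ≡ legR
  leg-≡ C (inj₁ (inj₁ (refl , refl))) = Legs.leg-≡ uv ut v≢t C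
  leg-≡ C (inj₁ (inj₂ (refl , refl))) = trans (R-sym u v) (Legs.leg-≡ uv ut v≢t C)
  leg-≡ C (inj₂ (inj₁ (refl , refl))) = Legs.leg-≡ ut uv (≢-sym v≢t) (IsCherry-swap C)
  leg-≡ C (inj₂ (inj₂ (refl , refl))) = trans (R-sym u t) (Legs.leg-≡ ut uv (≢-sym v≢t) (IsCherry-swap C))

  module EdgeOf {x y} = Resistance.Edge F connected c c-inv {x} {y}

  slack-nonneg : ∀ x y → 0ℚ ℚ.≤ slack x y
  slack-nonneg x y with classify x y
  ... | nonadjacent _ eq   = ℚₚ.≤-reflexive (sym eq)
  ... | other-edge xy _ eq = subst (0ℚ ℚ.≤_) (sym eq) (⊖-nonneg (EdgeOf.edge-≥ xy))
  ... | leg at eq          = subst (0ℚ ℚ.≤_) (sym eq) (⊖-nonneg (leg-≥ at))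

  IsCherry⇒slack≡0 : IsCherry F u v t → ∀ x y → slack x y ≡ 0ℚ
  IsCherry⇒slack≡0 C x y with classify x y
  ... | nonadjacent _ eq      = eq
  ... | leg at eq             = trans eq (⊖-self (leg-≡ C at))
  ... | other-edge xy ¬at eq  = trans eq (⊖-self (EdgeOf.edge-≡ xy
          (λ xz → other x≢u xz xy) (λ yz → other y≢u yz (Adj-sym F xy))))
    where
    open IsCherry C using (centre; other)
    -- By `centre` an edge at `u` would be a leg. With both endpoints away from `u`, `other` makes
    -- the edge isolated.
    x≢u : x ≢ u
    x≢u refl with centre xy
    ... | inj₁ y≡v = ¬at (inj₁ (inj₁ (refl , y≡v)))
    ... | inj₂ y≡t = ¬at (inj₂ (inj₁ (refl , y≡t)))
    y≢u : y ≢ u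
    y≢u refl with centre (Adj-sym F xy)
    ... | inj₁ x≡v = ¬at (inj₁ (inj₂ (x≡v , refl)))
    ... | inj₂ x≡t = ¬at (inj₂ (inj₂ (x≡t , refl)))

  slack≡0⇒IsCherry : (∀ x y → slack x y ≡ 0ℚ) → IsCherry F u v t
  slack≡0⇒IsCherry slack≡0 = record
    { v≢t = v≢t ; uv = uv ; ut = ut ; centre = centre ; other = other }
    where
    -- Off the legs zero slack means R(x, y) = 2c, which `edge-≢` refutes as soon as `x` has a
    -- second neighbour.
    isolated : ∀ {x y z} → Adj F x y → ¬ Leg u v t x y → Adj F x z → y ≡ z
    isolated {x} {y} {z} xy ¬at xz with y ≟ z
    ... | yes y≡z = y≡z
    ... | no  y≢z with classify x y
    ...   | nonadjacent ¬xy _  = ⊥-elim (¬xy xy)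
    ...   | leg at _           = ⊥-elim (¬at at)
    ...   | other-edge _ _ eq  = ⊥-elim (EdgeOf.edge-≢ xy xz y≢z (⊖-zero (trans (sym eq) (slack≡0 x y))))

    centre : ∀ {z} → Adj F u z → z ≡ v ⊎ z ≡ t
    centre {z} uz with z ≟ v | z ≟ t
    ... | yes z≡v | _       = inj₁ z≡v
    ... | no  _   | yes z≡t = inj₂ z≡t
    -- A third edge at the centre is no leg, so it is alone at `u`; the edge uv then forces `z ≡ v`.
    ... | no  z≢v | no  z≢t = inj₁ (isolated uz
          (λ { (inj₁ (inj₁ (_ , z≡v))) → z≢v z≡v ; (inj₁ (inj₂ (u≡v , _))) → u≢v u≡v
             ; (inj₂ (inj₁ (_ , z≡t))) → z≢t z≡t ; (inj₂ (inj₂ (u≡t , _))) → u≢t u≡t }) uv)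

    apart : ∀ {x y} → x ≢ u → y ≢ u → ¬ Leg u v t x y
    apart x≢u y≢u (inj₁ (inj₁ (x≡u , _))) = x≢u x≡u
    apart x≢u y≢u (inj₁ (inj₂ (_ , y≡u))) = y≢u y≡u
    apart x≢u y≢u (inj₂ (inj₁ (x≡u , _))) = x≢u x≡u
    apart x≢u y≢u (inj₂ (inj₂ (_ , y≡u))) = y≢u y≡u

    other : ∀ {x y z} → x ≢ u → Adj F x y → Adj F x z → y ≡ z
    -- An edge missing `u` is never a leg, so `isolated` applies to whichever of xy and xz misses
    -- `u`.
    other {x} {y} {z} x≢u xy xz with y ≟ u | z ≟ u
    ... | yes y≡u | yes z≡u = trans y≡u (sym z≡u)
    ... | no  y≢u | _       = isolated xy (apart x≢u y≢u) xz
    ... | yes _   | no z≢u  = sym (isolated xz (apart x≢u z≢u) xy)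

  bound : ℚ
  bound = kirchhoffBound n c γ (size F)

  -- An identity, so the sign of the slack gives the bound and its vanishing gives the equality
  -- case. The factor `2ℚ ⊕ 2ℚ` is the total weight of `cherry`: two legs, each in two ordered
  -- positions.
  Kf-slack : Kf (K n ∖ F) ⊕ Kf (K n ∖ F) ≡ (bound ⊕ bound) ⊕ ∑∑ slack
  Kf-slack = begin
    Kf (K n ∖ F) ⊕ Kf (K n ∖ F)
      ≡⟨ Kf-double u ⟩
    ((ι n ⊖ 1ℚ) ⊕ (ι n ⊖ 1ℚ)) ⊕ ∑aR
      ≡⟨ solve 5 (λ N s r l A →
           ((N :- con 1ℚ) :+ (N :- con 1ℚ)) :+ A :=
           ((N :- con 1ℚ) :+ r :* s :+ con 2ℚ :* (l :- r) :+ ((N :- con 1ℚ) :+ r :* s :+ con 2ℚ :* (l :- r)))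
             :+ (A :- (r :* (s :+ s) :+ (l :- r) :* (con 2ℚ :+ con 2ℚ))))
           refl (ι n) (ι (size F)) edgeR legR ∑aR ⟩
    (bound ⊕ bound) ⊕ (∑aR ⊖ (edgeR ⊛ (ι (size F) ⊕ ι (size F)) ⊕ (legR ⊖ edgeR) ⊛ (2ℚ ⊕ 2ℚ)))
      ≡⟨ cong ((bound ⊕ bound) ⊕_) (sym ∑slack) ⟩
    (bound ⊕ bound) ⊕ ∑∑ slack ∎
    where
    ∑aR : ℚ
    ∑aR = ∑∑ λ x y → a x y ⊛ R x y
    ∑slack : ∑∑ slack ≡ ∑aR ⊖ (edgeR ⊛ (ι (size F) ⊕ ι (size F)) ⊕ (legR ⊖ edgeR) ⊛ (2ℚ ⊕ 2ℚ))
    ∑slack = begin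
      ∑∑ slack
        ≡⟨ ∑∑-minus (λ x y → a x y ⊛ R x y) (λ x y → edgeR ⊛ a x y ⊕ (legR ⊖ edgeR) ⊛ cherry u v t x y) ⟩
      ∑aR ⊖ ∑∑ (λ x y → edgeR ⊛ a x y ⊕ (legR ⊖ edgeR) ⊛ cherry u v t x y)
        ≡⟨ cong (∑aR ⊖_) (∑∑-plus (λ x y → edgeR ⊛ a x y) (λ x y → (legR ⊖ edgeR) ⊛ cherry u v t x y)) ⟩
      ∑aR ⊖ (∑∑ (λ x y → edgeR ⊛ a x y) ⊕ ∑∑ (λ x y → (legR ⊖ edgeR) ⊛ cherry u v t x y))
        ≡⟨ cong₂ (λ p q → ∑aR ⊖ (p ⊕ q))
             (trans (∑∑-scale edgeR a) (cong (edgeR ⊛_) (∑∑-adjacency F)))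
             (trans (∑∑-scale (legR ⊖ edgeR) (cherry u v t)) (cong ((legR ⊖ edgeR) ⊛_)
               (trans (∑∑-plus (pair u v) (pair u t)) (cong₂ _⊕_ (∑∑-pair u v) (∑∑-pair u t))))) ⟩
      ∑aR ⊖ (edgeR ⊛ (ι (size F) ⊕ ι (size F)) ⊕ (legR ⊖ edgeR) ⊛ (2ℚ ⊕ 2ℚ)) ∎

  bound-≤ : bound ℚ.≤ Kf (K n ∖ F)
  bound-≤ = ≤-double (subst₂ ℚ._≤_ (ℚₚ.+-identityʳ (bound ⊕ bound)) (sym Kf-slack)
    (ℚₚ.+-monoʳ-≤ (bound ⊕ bound) (∑∑-nonneg slack slack-nonneg)))

  tight⇒IsCherry : Kf (K n ∖ F) ≡ bound → IsCherry F u v t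
  tight⇒IsCherry Kf≡ = slack≡0⇒IsCherry (∑∑-nonpos⇒zero slack slack-nonneg (ℚₚ.≤-reflexive (begin
    ∑∑ slack
      ≡⟨ solve 2 (λ b s → s := (b :+ s) :- b) refl (bound ⊕ bound) (∑∑ slack) ⟩
    (bound ⊕ bound ⊕ ∑∑ slack) ⊖ (bound ⊕ bound)
      ≡⟨ ⊖-self (trans (sym Kf-slack) (cong₂ _⊕_ Kf≡ Kf≡)) ⟩
    0ℚ ∎)))

  IsCherry⇒tight : IsCherry F u v t → Kf (K n ∖ F) ≡ bound
  IsCherry⇒tight C = ≡-double (begin
    Kf (K n ∖ F) ⊕ Kf (K n ∖ F)    ≡⟨ Kf-slack ⟩
    (bound ⊕ bound) ⊕ ∑∑ slack     ≡⟨ cong ((bound ⊕ bound) ⊕_)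
                                        (∑-zero _ λ x → ∑-zero (slack x) (IsCherry⇒slack≡0 C x)) ⟩
    (bound ⊕ bound) ⊕ 0ℚ           ≡⟨ ℚₚ.+-identityʳ (bound ⊕ bound) ⟩
    bound ⊕ bound                  ∎)

-- The arithmetic of the bound

ι-toℚᵘ : ∀ k → ℚ.toℚᵘ (ι k) ℚᵘ.≃ ℚᵘ.mkℚᵘ (ℤ.+ k) 0
ι-toℚᵘ zero    = ℚᵘ.*≡* refl
ι-toℚᵘ (suc k) = ℚᵘₚ.≃-trans (ℚₚ.toℚᵘ-homo-+ 1ℚ (ι k))
  (ℚᵘₚ.≃-trans (ℚᵘₚ.+-congʳ (ℚ.toℚᵘ 1ℚ) (ι-toℚᵘ k))
    (ℚᵘ.*≡* (cong (ℤ._* ℤ.1ℤ) (cong (λ i → ℤ.1ℤ ℤ.+ i) (ℤₚ.*-identityʳ (ℤ.+ k))))))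

-- Normalised quotients do not compute for variable `i` and `k`; among unnormalised rationals the
-- claim is a cross-multiplication of integers.
/-⊛-ι : ∀ i k → (ℤ.+ i ℚ./ suc k) ⊛ ι (suc k) ≡ ι i
/-⊛-ι i k = ℚₚ.toℚᵘ-injective (ℚᵘₚ.≃-trans (ℚₚ.toℚᵘ-homo-* (ℤ.+ i ℚ./ suc k) (ι (suc k)))
  (ℚᵘₚ.≃-trans (ℚᵘₚ.*-cong (ℚₚ.toℚᵘ-fromℚᵘ (ℚᵘ.mkℚᵘ (ℤ.+ i) k)) (ι-toℚᵘ (suc k)))
    (ℚᵘₚ.≃-trans (ℚᵘ.*≡* (trans (ℤₚ.*-identityʳ (ℤ.+ i ℤ.* ℤ.+ suc k))
        (cong (λ l → ℤ.+ i ℤ.* ℤ.+ l) (sym (ℕₚ.*-identityʳ (suc k))))))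
      (ℚᵘₚ.≃-sym (ι-toℚᵘ i)))))

recip : ℕ → ℚ
recip k = ℤ.+ 1 ℚ./ suc k

recip-inv : ∀ k → recip k ⊛ ι (suc k) ≡ 1ℚ
recip-inv k = /-⊛-ι 1 k

/-recip : ∀ i k → ℤ.+ i ℚ./ suc k ≡ ι i ⊛ recip k
/-recip i k = begin
  q                              ≡⟨ ℚₚ.*-identityʳ q ⟨
  q ⊛ 1ℚ                         ≡⟨ cong (q ⊛_) (recip-inv k) ⟨
  q ⊛ (recip k ⊛ ι (suc k))      ≡⟨ solve 3 (λ q r s → q :* (r :* s) := q :* s :* r) refl q (recip k) (ι (suc k)) ⟩
  q ⊛ ι (suc k) ⊛ recip k        ≡⟨ cong (_⊛ recip k) (/-⊛-ι i k) ⟩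
  ι i ⊛ recip k                  ∎
  where
  q : ℚ
  q = ℤ.+ i ℚ./ suc k

ι-injective : ∀ {k l} → ι k ≡ ι l → k ≡ l
ι-injective {k} {l} eq with ℚᵘₚ.≃-trans (ℚᵘₚ.≃-sym (ι-toℚᵘ k)) (ℚᵘₚ.≃-trans (ℚᵘₚ.≃-reflexive (cong ℚ.toℚᵘ eq)) (ι-toℚᵘ l))
... | ℚᵘ.*≡* eq′ = ℤₚ.+-injective (trans (sym (ℤₚ.*-identityʳ (ℤ.+ k))) (trans eq′ (ℤₚ.*-identityʳ (ℤ.+ l))))

-- With n = 4 + m the numbers n - 1, n - 2 and n - 3 are visibly successors, and `recip k` is 1/(k +
-- 1).
module Reciprocals (m : ℕ) where

  c γ : ℚ
  c = recip (suc m)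
  γ = recip (2 ℕ.+ m) ⊛ recip m

  c-inv : c ⊛ (ι (4 ℕ.+ m) ⊖ 2ℚ) ≡ 1ℚ
  c-inv = trans (cong (c ⊛_) (solve 1 (λ M → (con 1ℚ :+ (con 1ℚ :+ (con 1ℚ :+ (con 1ℚ :+ M)))) :- con 2ℚ
                                             := con 1ℚ :+ (con 1ℚ :+ M)) refl (ι m)))
                (recip-inv (suc m))

  γ-inv : γ ⊛ ((ι (4 ℕ.+ m) ⊖ 1ℚ) ⊛ (ι (4 ℕ.+ m) ⊖ 3ℚ)) ≡ 1ℚ
  γ-inv = trans
    (solve 3 (λ p q M → p :* q :* (((con 1ℚ :+ (con 1ℚ :+ (con 1ℚ :+ (con 1ℚ :+ M)))) :- con 1ℚ)
                                :* ((con 1ℚ :+ (con 1ℚ :+ (con 1ℚ :+ (con 1ℚ :+ M)))) :- con 3ℚ))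
                        := (p :* (con 1ℚ :+ (con 1ℚ :+ (con 1ℚ :+ M)))) :* (q :* (con 1ℚ :+ M)))
       refl (recip (2 ℕ.+ m)) (recip m) (ι m))
    (cong₂ _⊛_ (recip-inv (2 ℕ.+ m)) (recip-inv m))

  lowerBound-≡ : ∀ k (4≤n : 4 ≤ 4 ℕ.+ m) →
                 lowerBound (4 ℕ.+ m) (2 ℕ.+ k) 4≤n ≡ kirchhoffBound (4 ℕ.+ m) c γ (2 ℕ.+ k)
  lowerBound-≡ k _ = begin
    (ℤ.+ (3 ℕ.+ m) ℚ./ 1) ⊕ (ℤ.+ 3 ℚ./ suc m) ⊕ p ⊕ (ℤ.+ (2 ℕ.* k) ℚ./ (2 ℕ.+ m))
      -- Inserting p(n - 1) = 1 beside 3q and q(n - 3) = 1 beside p brings both over the common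
      -- denominator. The rest is the ring identity 3(n - 1) + (n - 3) = 2(2n - 3).
      ≡⟨ cong₂ _⊕_ (cong₂ _⊕_ (cong₂ _⊕_
           (trans (/-recip (3 ℕ.+ m) 0) (ℚₚ.*-identityʳ (ι (3 ℕ.+ m))))
           (trans (/-recip 3 m) (trans (sym (ℚₚ.*-identityʳ (3ℚ ⊛ q)))
              (cong (3ℚ ⊛ q ⊛_) (sym (recip-inv (2 ℕ.+ m)))))))
           (trans (sym (ℚₚ.*-identityʳ p)) (cong (p ⊛_) (sym (recip-inv m)))))
           (trans (/-recip (2 ℕ.* k) (suc m)) (cong (_⊛ c) (trans (cong ι (cong (k ℕ.+_) (ℕₚ.+-identityʳ k))) (ι-+ k k)))) ⟩
    ι (3 ℕ.+ m) ⊕ 3ℚ ⊛ q ⊛ (p ⊛ ι (3 ℕ.+ m)) ⊕ p ⊛ (q ⊛ ι (suc m)) ⊕ (ι k ⊕ ι k) ⊛ c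
      ≡⟨ solve 5 (λ p q c K M →
           let M₁ = con 1ℚ :+ M
               M₃ = con 1ℚ :+ (con 1ℚ :+ M₁)
               N  = con 1ℚ :+ M₃
           in M₃ :+ con 3ℚ :* q :* (p :* M₃) :+ p :* (q :* M₁) :+ (K :+ K) :* c
              := (N :- con 1ℚ) :+ (c :+ c) :* (con 1ℚ :+ (con 1ℚ :+ K))
                   :+ con 2ℚ :* (p :* q :* (N :+ N :- con 3ℚ) :- (c :+ c)))
           refl p q c (ι k) (ι m) ⟩
    kirchhoffBound (4 ℕ.+ m) c γ (2 ℕ.+ k) ∎
    where
    p q : ℚ
    p = recip (2 ℕ.+ m)
    q = recip m

-- Confines the split n = 4 + m and the truncated subtractions to this place; what follows knows the
-- reciprocals only by their inverse equations.
lowerBound-coefficients : ∀ n (4≤n : 4 ≤ n) → ∃ λ c → ∃ λ γ →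
  c ⊛ (ι n ⊖ 2ℚ) ≡ 1ℚ × γ ⊛ ((ι n ⊖ 1ℚ) ⊛ (ι n ⊖ 3ℚ)) ≡ 1ℚ ×
  (∀ p → 2 ≤ p → lowerBound n p 4≤n ≡ kirchhoffBound n c γ p)
lowerBound-coefficients (suc (suc (suc (suc m)))) 4≤n@(s≤s (s≤s (s≤s (s≤s z≤n)))) =
  c , γ , c-inv , γ-inv , λ { (suc (suc k)) (s≤s (s≤s z≤n)) → lowerBound-≡ k 4≤n }
  where open Reciprocals m

-- Labelled copies of P₃ ∪ kK₂ and their number of edges

Pattern : ℕ → Set
Pattern k = Fin 3 ⊎ (Fin k × Fin 2)

P₃∪_K₂ : ∀ k → SimpleGraph (Pattern k)
P₃∪ k K₂ = P 3 ⊍ copies k (K 2)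

module _ {k : ℕ} where

  mid : Pattern k
  mid = inj₁ 1F

  -- The only neighbour of every vertex except `mid`, which receives an arbitrary one of its two. It
  -- shows that each label is an endpoint and determines adjacency away from `mid`.
  neighbour : Pattern k → Pattern k
  neighbour (inj₁ 0F)       = mid
  neighbour (inj₁ 1F)       = inj₁ 0F
  neighbour (inj₁ 2F)       = mid
  neighbour (inj₂ (i , 0F)) = inj₂ (i , 1F)
  neighbour (inj₂ (i , 1F)) = inj₂ (i , 0F)

  Adj-neighbour : ∀ s → Adj (P₃∪ k K₂) s (neighbour s)
  Adj-neighbour (inj₁ 0F) = _
  Adj-neighbour (inj₁ 1F) = _
  Adj-neighbour (inj₁ 2F) = _
  Adj-neighbour (inj₂ (i , 0F)) rewrite dec-true (i ≟ i) refl = _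
  Adj-neighbour (inj₂ (i , 1F)) rewrite dec-true (i ≟ i) refl = _

  neighbour-unique : ∀ {s s′} → s ≢ mid → Adj (P₃∪ k K₂) s s′ → s′ ≡ neighbour s
  neighbour-unique {inj₁ 0F} {inj₁ 1F} _ _ = refl
  neighbour-unique {inj₁ 2F} {inj₁ 1F} _ _ = refl
  neighbour-unique {inj₁ 2F} {inj₁ 2F} _ ()
  neighbour-unique {inj₁ 1F} s≢mid _ = ⊥-elim (s≢mid refl)
  neighbour-unique {inj₂ (i , _)} {inj₂ (j , _)} _ adj with i ≟ j
  neighbour-unique {inj₂ (i , 0F)} {inj₂ (i , 1F)} _ _ | yes refl = refl
  neighbour-unique {inj₂ (i , 1F)} {inj₂ (i , 0F)} _ _ | yes refl = refl
  neighbour-unique {inj₂ (i , 1F)} {inj₂ (i , 1F)} _ () | yes refl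

  neighbour-mid : ∀ s → Adj (P₃∪ k K₂) mid s → s ≡ inj₁ 0F ⊎ s ≡ inj₁ 2F
  neighbour-mid (inj₁ 0F) _ = inj₁ refl
  neighbour-mid (inj₁ 2F) _ = inj₂ refl

  mid? : (s : Pattern k) → Dec (s ≡ mid)
  mid? (inj₁ 0F) = no λ ()
  mid? (inj₁ 1F) = yes refl
  mid? (inj₁ 2F) = no λ ()
  mid? (inj₂ _)  = no λ ()

-- An isomorphism with the deletion graph, recast as an injection into `Fin n` whose image is the
-- set of endpoints; this keeps the refinement type out of the combinatorics.
record Labelling {n} (F : EdgeSet n) (k : ℕ) : Set where
  field
    ψ           : Pattern k → Fin n
    injective   : ∀ {s s′} → ψ s ≡ ψ s′ → s ≡ s′
    surjective  : ∀ {x y} → Adj F x y → ∃ λ s → ψ s ≡ x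
    preserves   : ∀ s s′ → adj F (ψ s) (ψ s′) ≡ adj (P₃∪ k K₂) s s′

  Adj-ψ : ∀ {s s′} → Adj (P₃∪ k K₂) s s′ → Adj F (ψ s) (ψ s′)
  Adj-ψ {s} {s′} = subst T (sym (preserves s s′))

  Adj-ψ⁻ : ∀ {s s′} → Adj F (ψ s) (ψ s′) → Adj (P₃∪ k K₂) s s′
  Adj-ψ⁻ {s} {s′} = subst T (preserves s s′)

value-injective : ∀ {n} {F : EdgeSet n} {e f : Endpoints F} → value e ≡ value f → e ≡ f
value-injective {e = x ,ʳ _} {.x ,ʳ _} refl = refl

≅⇒Labelling : ∀ {n k} {F : EdgeSet n} → deletionGraph F ≅ P₃∪ k K₂ → Labelling F k
≅⇒Labelling {F = F} iso = record
  { ψ          = λ s → value (from s)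
  ; injective  = λ {s} {s′} eq → trans (sym (strictlyInverseˡ s))
                   (trans (cong to (value-injective {F = F} eq)) (strictlyInverseˡ s′))
  ; surjective = λ {x} {y} xy → to (x ,ʳ [ y , xy ]) , cong value (strictlyInverseʳ (x ,ʳ [ y , xy ]))
  ; preserves  = λ s s′ → trans (preserves (from s) (from s′))
                   (cong₂ (adj (P₃∪ _ K₂)) (strictlyInverseˡ s) (strictlyInverseˡ s′))
  }
  where
  open _≅_ iso
  open Inverse vertices using (to; from; strictlyInverseˡ; strictlyInverseʳ)

Labelling⇒≅ : ∀ {n k} {F : EdgeSet n} → Labelling F k → deletionGraph F ≅ P₃∪ k K₂
Labelling⇒≅ {n} {k} {F} labelling = record
  { vertices  = mk↔ₛ′ to from (λ s → injective (ψ-to (from s))) (λ e → value-injective {F = F} (ψ-to e))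
  ; preserves = λ e f → trans (cong₂ (adj F) (sym (ψ-to e)) (sym (ψ-to f))) (preserves (to e) (to f))
  }
  where
  open Labelling labelling
  label : (e : Endpoints F) → ∃ λ s → ψ s ≡ value e
  -- The membership proof is irrelevant, but having a neighbour is decidable, so a usable neighbour
  -- can be recomputed.
  label (x ,ʳ [ xy ]) = surjective (proj₂ (recompute (Finₚ.any? λ y → T? (adj F x y)) xy))
  to : Endpoints F → Pattern k
  to e = proj₁ (label e)
  ψ-to : ∀ e → ψ (to e) ≡ value e
  ψ-to e = proj₂ (label e)
  from : Pattern k → Endpoints F
  from s = ψ s ,ʳ [ ψ (neighbour s) , Adj-ψ (Adj-neighbour s) ]

module _ {n k} {F : EdgeSet n} (labelling : Labelling F k) where

  open Labelling labelling

  Labelling⇒IsCherry : IsCherry F (ψ mid) (ψ (inj₁ 0F)) (ψ (inj₁ 2F))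
  Labelling⇒IsCherry = record
    { v≢t = λ eq → case-≢ (injective eq) ; uv = Adj-ψ _ ; ut = Adj-ψ _ ; centre = centre ; other = other }
    where
    case-≢ : ¬ (inj₁ 0F ≡ inj₁ {B = Fin k × Fin 2} 2F)
    case-≢ ()
    centre : ∀ {z} → Adj F (ψ mid) z → z ≡ ψ (inj₁ 0F) ⊎ z ≡ ψ (inj₁ 2F)
    centre uz with surjective (Adj-sym F uz)
    ... | s , refl with neighbour-mid s (Adj-ψ⁻ uz)
    ...   | inj₁ refl = inj₁ refl
    ...   | inj₂ refl = inj₂ refl
    other : ∀ {x y z} → x ≢ ψ mid → Adj F x y → Adj F x z → y ≡ z
    other x≢u xy xz with surjective xy | surjective (Adj-sym F xy) | surjective (Adj-sym F xz)
    ... | s , refl | s₁ , refl | s₂ , refl = cong ψ (trans (unique xy) (sym (unique xz)))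
      where
      unique : ∀ {s′} → Adj F (ψ s) (ψ s′) → s′ ≡ neighbour s
      unique ss′ = neighbour-unique (λ s≡mid → x≢u (cong ψ s≡mid)) (Adj-ψ⁻ ss′)

  private
    labels : Fin (3 ℕ.+ k ℕ.* 2) ↔ Pattern k
    labels = ↔-trans Finₚ.+↔⊎ (↔-refl ⊎-↔ Finₚ.*↔×)

    open Inverse labels using (to; from; strictlyInverseˡ; strictlyInverseʳ)

    ψ̂ : Fin (3 ℕ.+ k ℕ.* 2) → Fin n
    ψ̂ i = ψ (to i)

    -- Indicator of the image of `ψ`, given as a sum over labels so that exchanging sums yields its
    -- total 3 + 2k.
    endpoint : Vector ℚ n
    endpoint x = ∑[ i < 3 ℕ.+ k ℕ.* 2 ] basis (ψ̂ i) x

    endpoint-ψ : ∀ s → endpoint (ψ s) ≡ 1ℚ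
    endpoint-ψ s = trans (sum-cong-≗ same) (∑-basis-1 (from s))
      where
      same : ∀ i → basis (ψ̂ i) (ψ s) ≡ basis (from s) i
      same i with from s ≟ i
      ... | yes refl = trans (cong (λ t → basis t (ψ s)) (cong ψ (strictlyInverseˡ s))) (basis-refl (ψ s))
      ... | no  s≢i  = basis-≢ λ eq → s≢i (trans (cong from (sym (injective eq))) (strictlyInverseʳ i))

    open IsCherry Labelling⇒IsCherry using (v≢t; uv; ut; centre; other)

    u v t : Fin n
    u = ψ mid
    v = ψ (inj₁ 0F)
    t = ψ (inj₁ 2F)

    degree-mid : sum (adjacency F u) ≡ 2ℚ
    degree-mid = begin
      sum (adjacency F u)                      ≡⟨ sum-cong-≗ row ⟩
      ∑[ z < n ] (basis v z ⊕ basis t z)       ≡⟨ ∑-distrib-+ (basis v) (basis t) ⟩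
      sum (basis v) ⊕ sum (basis t)            ≡⟨ cong₂ _⊕_ (∑-basis-1 v) (∑-basis-1 t) ⟩
      2ℚ                                       ∎
      where
      row : ∀ z → adjacency F u z ≡ basis v z ⊕ basis t z
      row z with v ≟ z | t ≟ z
      ... | yes refl | yes t≡v  = ⊥-elim (v≢t (sym t≡v))
      ... | yes refl | no  _    = Adj⇒adjacency F uv
      ... | no  _    | yes refl = Adj⇒adjacency F ut
      ... | no  v≢z  | no  t≢z with adjacency-01 F u z
      ...   | inj₂ (_ , eq) = eq
      ...   | inj₁ (uz , _) with centre uz
      ...     | inj₁ z≡v = ⊥-elim (v≢z (sym z≡v))
      ...     | inj₂ z≡t = ⊥-elim (t≢z (sym z≡t))

    degree-other : ∀ {x y} → x ≢ u → Adj F x y → sum (adjacency F x) ≡ 1ℚ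
    degree-other {x} {y} x≢u xy = trans (sum-cong-≗ row) (∑-basis-1 y)
      where
      row : ∀ z → adjacency F x z ≡ basis y z
      row z with y ≟ z
      ... | yes refl = Adj⇒adjacency F xy
      ... | no  y≢z with adjacency-01 F x z
      ...   | inj₁ (xz , _) = ⊥-elim (y≢z (other x≢u xy xz))
      ...   | inj₂ (_ , eq) = eq

    -- Endpoints have degree 1 except for the centre with degree 2, which the extra basis vector
    -- accounts for.
    degree-endpoint : ∀ x → sum (adjacency F x) ≡ endpoint x ⊕ basis u x
    degree-endpoint x with Finₚ.any? (λ y → T? (adj F x y))
    ... | no ¬xy = trans (∑-zero (adjacency F x) isolated)
          (sym (cong₂ _⊕_ (∑-zero (λ i → basis (ψ̂ i) x) (λ i → basis-≢ (unlabelled (to i)))) (basis-≢ (unlabelled mid))))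
      where
      isolated : ∀ y → adjacency F x y ≡ 0ℚ
      isolated y with adjacency-01 F x y
      ... | inj₁ (xy , _) = ⊥-elim (¬xy (y , xy))
      ... | inj₂ (_ , eq) = eq
      unlabelled : ∀ s → ψ s ≢ x
      unlabelled s refl = ¬xy (ψ (neighbour s) , Adj-ψ (Adj-neighbour s))
    ... | yes (y , xy) with surjective xy
    ...   | s , refl with mid? s
    ...     | yes refl = trans degree-mid (sym (cong₂ _⊕_ (endpoint-ψ mid) (basis-refl u)))
    ...     | no s≢mid = trans (degree-other (λ x≡u → s≢mid (injective x≡u)) xy)
              (sym (cong₂ _⊕_ (endpoint-ψ s) (basis-≢ λ u≡x → s≢mid (sym (injective u≡x)))))

  -- Handshake: twice the size is (3 + 2k) + 1. This recovers k = p - 2 for an extremal F and the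
  -- size of a set known only up to isomorphism.
  Labelling⇒size : size F ≡ 2 ℕ.+ k
  Labelling⇒size = ℕ-double (ι-injective (begin
    ι (size F ℕ.+ size F)                          ≡⟨ ι-+ (size F) (size F) ⟩
    ι (size F) ⊕ ι (size F)                        ≡⟨ ∑∑-adjacency F ⟨
    ∑∑ (adjacency F)                               ≡⟨ sum-cong-≗ degree-endpoint ⟩
    ∑[ x < n ] (endpoint x ⊕ basis u x)            ≡⟨ ∑-distrib-+ endpoint (basis u) ⟩
    sum endpoint ⊕ sum (basis u)                   ≡⟨ cong₂ _⊕_ ∑-endpoint (∑-basis-1 u) ⟩
    ι (3 ℕ.+ k ℕ.* 2) ⊕ 1ℚ                         ≡⟨ ι-+ (3 ℕ.+ k ℕ.* 2) 1 ⟨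
    ι (3 ℕ.+ k ℕ.* 2 ℕ.+ 1)                        ≡⟨ cong ι arith ⟩
    ι ((2 ℕ.+ k) ℕ.+ (2 ℕ.+ k))                    ∎))
    where
    ∑-endpoint : sum endpoint ≡ ι (3 ℕ.+ k ℕ.* 2)
    ∑-endpoint = begin
      ∑[ x < n ] ∑[ i < 3 ℕ.+ k ℕ.* 2 ] basis (ψ̂ i) x   ≡⟨ ∑-comm (λ x i → basis (ψ̂ i) x) ⟩
      ∑[ i < 3 ℕ.+ k ℕ.* 2 ] sum (basis (ψ̂ i))          ≡⟨ sum-cong-≗ (λ i → ∑-basis-1 (ψ̂ i)) ⟩
      ∑[ i < 3 ℕ.+ k ℕ.* 2 ] 1ℚ                          ≡⟨ ∑-1 (3 ℕ.+ k ℕ.* 2) ⟩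
      ι (3 ℕ.+ k ℕ.* 2)                                  ∎
    arith : 3 ℕ.+ k ℕ.* 2 ℕ.+ 1 ≡ (2 ℕ.+ k) ℕ.+ (2 ℕ.+ k)
    arith = S.solve 1 (λ k → S.con 3 S.:+ k S.:* S.con 2 S.:+ S.con 1
                             S.:= (S.con 2 S.:+ k) S.:+ (S.con 2 S.:+ k)) refl k
      where module S = ℕ-Solver.+-*-Solver
    ℕ-double : ∀ {k l} → k ℕ.+ k ≡ l ℕ.+ l → k ≡ l
    ℕ-double {k} {l} eq = ℕₚ.*-cancelˡ-≡ k l 2
      (trans (cong (k ℕ.+_) (ℕₚ.+-identityʳ k)) (trans eq (cong (l ℕ.+_) (sym (ℕₚ.+-identityʳ l)))))

-- From `IsCherry` back to a labelling

record Enumeration {n} (S : Fin n → Set) : Set where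
  field
    count      : ℕ
    element    : Fin count → Fin n
    injective  : ∀ {i j} → element i ≡ element j → i ≡ j
    satisfies  : ∀ i → S (element i)
    surjective : ∀ {x} → S x → ∃ λ i → element i ≡ x

-- Supplies the index set of the K₂ components. Their number is an output, identified with p - 2
-- only afterwards by `Labelling⇒size`.
enumerate : ∀ {n} {S : Fin n → Set} → Decidable S → Enumeration S
enumerate {zero} S? = record
  { count = 0 ; element = λ () ; injective = λ {} ; satisfies = λ () ; surjective = λ { {()} } }
enumerate {suc n} {S} S? with S? zero
... | no ¬z = record
  { count = count ; element = λ i → suc (element i)
  ; injective = λ eq → injective (Finₚ.suc-injective eq)
  ; satisfies = satisfies
  ; surjective = λ { {zero} z → ⊥-elim (¬z z) ; {suc x} sx → let i , eq = surjective sx in i , cong suc eq } }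
  where open Enumeration (enumerate (λ x → S? (suc x)))
... | yes z = record
  { count = suc count ; element = element′
  ; injective = injective′
  ; satisfies = λ { zero → z ; (suc i) → satisfies i }
  ; surjective = λ { {zero} _ → zero , refl ; {suc x} sx → let i , eq = surjective sx in suc i , cong suc eq } }
  where
  open Enumeration (enumerate (λ x → S? (suc x)))
  element′ : Fin (suc count) → Fin (suc n)
  element′ zero    = zero
  element′ (suc i) = suc (element i)
  injective′ : ∀ {i j} → element′ i ≡ element′ j → i ≡ j
  injective′ {zero}  {zero}  _  = refl
  injective′ {suc i} {suc j} eq = cong suc (injective (Finₚ.suc-injective eq))

T-ext : ∀ {b b′} → (T b → T b′) → (T b′ → T b) → b ≡ b′
T-ext {false} {false} _ _ = refl
T-ext {true}  {true}  _ _ = refl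
T-ext {false} {true}  _ g = ⊥-elim (g _)
T-ext {true}  {false} f _ = ⊥-elim (f _)

module _ {n} {F : EdgeSet n} {u v t} (isCherry : IsCherry F u v t) where

  open IsCherry isCherry

  private
    u≢v : u ≢ v
    u≢v = Adj⇒≢ F uv

    u≢t : u ≢ t
    u≢t = Adj⇒≢ F ut

    Outside : Fin n → Set
    Outside x = x ≢ u × x ≢ v × x ≢ t

    -- The neighbours of `u` are `v` and `t`, and the only neighbour of either leaf is `u`, so no
    -- edge of F leaves the path.
    Outside-Adj : ∀ {x y} → Outside x → Adj F x y → Outside y
    Outside-Adj {x} {y} (x≢u , x≢v , x≢t) xy = y≢u , y≢leaf x≢u u≢v uv , y≢leaf x≢u u≢t ut
      where
      y≢u : y ≢ u
      y≢u refl with centre (Adj-sym F xy)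
      ... | inj₁ x≡v = x≢v x≡v
      ... | inj₂ x≡t = x≢t x≡t
      y≢leaf : ∀ {l} → x ≢ u → u ≢ l → Adj F u l → y ≢ l
      y≢leaf x≢u u≢l ul refl = x≢u (other (≢-sym u≢l) (Adj-sym F xy) (Adj-sym F ul))

    -- The smaller endpoints of the edges that miss the path.
    Lower : Fin n → Set
    Lower x = Outside x × ∃ λ y → Adj F x y × x Fin.< y

    Lower? : Decidable Lower
    Lower? x = (¬? (x ≟ u) ×-dec ¬? (x ≟ v) ×-dec ¬? (x ≟ t))
               ×-dec Finₚ.any? (λ y → T? (adj F x y) ×-dec x <? y)

    open Enumeration (enumerate Lower?)
      renaming (injective to element-injective; surjective to element-surjective)

    partner : Fin count → Fin n
    partner i = proj₁ (proj₂ (satisfies i))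

    edge : ∀ i → Adj F (element i) (partner i)
    edge i = proj₁ (proj₂ (proj₂ (satisfies i)))

    element<partner : ∀ i → element i Fin.< partner i
    element<partner i = proj₂ (proj₂ (proj₂ (satisfies i)))

    label : Pattern count → Fin n
    label (inj₁ 0F)       = v
    label (inj₁ 1F)       = u
    label (inj₁ 2F)       = t
    label (inj₂ (i , 0F)) = element i
    label (inj₂ (i , 1F)) = partner i

    label-outside : ∀ p → Outside (label (inj₂ p))
    label-outside (i , 0F) = proj₁ (satisfies i)
    label-outside (i , 1F) = Outside-Adj (proj₁ (satisfies i)) (edge i)

    label-≢ : ∀ j p → label (inj₁ j) ≢ label (inj₂ p)
    label-≢ 0F p eq = proj₁ (proj₂ (label-outside p)) (sym eq)
    label-≢ 1F p eq = proj₁ (label-outside p) (sym eq)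
    label-≢ 2F p eq = proj₂ (proj₂ (label-outside p)) (sym eq)

    mates : ∀ {p q y z} → label (inj₂ p) ≡ label (inj₂ q) →
            Adj F (label (inj₂ p)) y → Adj F (label (inj₂ q)) z → y ≡ z
    mates {p} {q} eq py qz = other (proj₁ (label-outside p)) py (subst (λ x → Adj F x _) (sym eq) qz)

    -- If the lower end of edge i were the upper end of edge j, uniqueness of neighbours would make
    -- the two edges coincide with opposite orders of their ends.
    element≢partner : ∀ i j → element i ≢ partner j
    element≢partner i j eq = Finₚ.<-asym (subst (Fin._< partner i) eq (element<partner i))
      (subst (Fin._< partner j)
        (sym (mates {i , 0F} {j , 1F} eq (edge i) (Adj-sym F (edge j)))) (element<partner j))

    label-injective : ∀ {s s′} → label s ≡ label s′ → s ≡ s′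
    label-injective {inj₁ 0F} {inj₁ 0F} _  = refl
    label-injective {inj₁ 0F} {inj₁ 1F} eq = ⊥-elim (u≢v (sym eq))
    label-injective {inj₁ 0F} {inj₁ 2F} eq = ⊥-elim (v≢t eq)
    label-injective {inj₁ 1F} {inj₁ 0F} eq = ⊥-elim (u≢v eq)
    label-injective {inj₁ 1F} {inj₁ 1F} _  = refl
    label-injective {inj₁ 1F} {inj₁ 2F} eq = ⊥-elim (u≢t eq)
    label-injective {inj₁ 2F} {inj₁ 0F} eq = ⊥-elim (v≢t (sym eq))
    label-injective {inj₁ 2F} {inj₁ 1F} eq = ⊥-elim (u≢t (sym eq))
    label-injective {inj₁ 2F} {inj₁ 2F} _  = refl
    label-injective {inj₁ j} {inj₂ q} eq = ⊥-elim (label-≢ j q eq)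
    label-injective {inj₂ p} {inj₁ j} eq = ⊥-elim (label-≢ j p (sym eq))
    label-injective {inj₂ (i , 0F)} {inj₂ (j , 0F)} eq = cong (λ i → inj₂ (i , 0F)) (element-injective eq)
    label-injective {inj₂ (i , 0F)} {inj₂ (j , 1F)} eq = ⊥-elim (element≢partner i j eq)
    label-injective {inj₂ (i , 1F)} {inj₂ (j , 0F)} eq = ⊥-elim (element≢partner j i (sym eq))
    label-injective {inj₂ (i , 1F)} {inj₂ (j , 1F)} eq = cong (λ i → inj₂ (i , 1F))
      (element-injective (mates {i , 1F} {j , 1F} eq (Adj-sym F (edge i)) (Adj-sym F (edge j))))

    label-surjective : ∀ {x y} → Adj F x y → ∃ λ s → label s ≡ x
    label-surjective {x} {y} xy with x ≟ u | x ≟ v | x ≟ t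
    ... | yes refl | _        | _        = mid , refl
    ... | no  _    | yes refl | _        = inj₁ 0F , refl
    ... | no  _    | no  _    | yes refl = inj₁ 2F , refl
    ... | no  x≢u  | no  x≢v  | no  x≢t with Finₚ.<-cmp x y
    ...   | tri< x<y _ _ = let i , eq = element-surjective ((x≢u , x≢v , x≢t) , y , xy , x<y)
                           in inj₂ (i , 0F) , eq
    ...   | tri≈ _ x≡y _ = ⊥-elim (Adj⇒≢ F xy x≡y)
    -- Now `y` is the enumerated lower end, and `x` is its only neighbour, hence its partner.
    ...   | tri> _ _ y<x = inj₂ (i , 1F) ,
            other (proj₁ (label-outside (i , 0F))) (edge i) (subst (λ y → Adj F y x) (sym eq) (Adj-sym F xy))
      where
      found = element-surjective (Outside-Adj (x≢u , x≢v , x≢t) xy , x , Adj-sym F xy , y<x)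
      i = proj₁ found
      eq = proj₂ found

    Adj-label-neighbour : ∀ s → Adj F (label s) (label (neighbour s))
    Adj-label-neighbour (inj₁ 0F)       = Adj-sym F uv
    Adj-label-neighbour (inj₁ 1F)       = uv
    Adj-label-neighbour (inj₁ 2F)       = Adj-sym F ut
    Adj-label-neighbour (inj₂ (i , 0F)) = edge i
    Adj-label-neighbour (inj₂ (i , 1F)) = Adj-sym F (edge i)

    label-preserves : ∀ s s′ → Adj (P₃∪ count K₂) s s′ → Adj F (label s) (label s′)
    label-preserves s s′ ss′ with mid? s
    ... | no s≢mid = subst (λ s′ → Adj F (label s) (label s′)) (sym (neighbour-unique s≢mid ss′)) (Adj-label-neighbour s)
    ... | yes refl with neighbour-mid s′ ss′
    ...   | inj₁ refl = uv
    ...   | inj₂ refl = ut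

    -- Away from `mid` the vertex `label s` has a single neighbour in F, namely
    -- `label (neighbour s)`, and injectivity identifies the labels.
    label-reflects : ∀ s s′ → Adj F (label s) (label s′) → Adj (P₃∪ count K₂) s s′
    label-reflects s s′ ss′ with mid? s
    ... | no s≢mid = subst (Adj (P₃∪ count K₂) s)
          (label-injective (other (λ eq → s≢mid (label-injective eq)) (Adj-label-neighbour s) ss′))
          (Adj-neighbour s)
    ... | yes refl with centre ss′
    ...   | inj₁ s′≡v with label-injective {s′} {inj₁ 0F} s′≡v
    ...     | refl = _
    label-reflects s s′ ss′ | yes refl | inj₂ s′≡t with label-injective {s′} {inj₁ 2F} s′≡t
    ... | refl = _

  IsCherry⇒Labelling : ∃ λ k → Labelling F k
  IsCherry⇒Labelling = count , record
    { ψ = label ; injective = label-injective ; surjective = label-surjective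
    ; preserves = λ s s′ → T-ext (label-reflects s s′) (label-preserves s s′) }

-- Connectivity of the extremal graph

avoid-three : ∀ {n} → 4 ≤ n → (a b c : Fin n) → ∃ λ z → z ≢ a × z ≢ b × z ≢ c
avoid-three {n} 4≤n a b c with Finₚ.any? (λ z → ¬? (z ≟ a) ×-dec ¬? (z ≟ b) ×-dec ¬? (z ≟ c))
... | yes found = found
... | no ¬found =
  -- If every vertex were among the three, four positions would share three names.
  let i , j , i<j , eq = Finₚ.pigeonhole 4≤n (λ z → proj₁ (which z))
  in ⊥-elim (Finₚ.<⇒≢ i<j (trans (proj₂ (which i)) (trans (cong pick eq) (sym (proj₂ (which j))))))
  where
  pick : Fin 3 → Fin n
  pick 0F = a
  pick 1F = b
  pick 2F = c
  which : ∀ z → ∃ λ k → z ≡ pick k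
  which z with z ≟ a | z ≟ b | z ≟ c
  ... | yes z≡a | _       | _       = 0F , z≡a
  ... | no  _   | yes z≡b | _       = 1F , z≡b
  ... | no  _   | no  _   | yes z≡c = 2F , z≡c
  ... | no  z≢a | no  z≢b | no  z≢c = ⊥-elim (¬found (z , z≢a , z≢b , z≢c))

-- Connectivity has to be derived for F₀. Each deleted edge is bypassed through one further vertex:
-- a vertex off the path if the edge is a leg, any third vertex otherwise. For n = 3 the centre
-- would be isolated, so `4 ≤ n` is essential.
IsCherry⇒connected : ∀ {n} {F : EdgeSet n} {u v t} → 4 ≤ n → IsCherry F u v t → Connected (K n ∖ F)
IsCherry⇒connected {n} {F} {u} {v} {t} 4≤n isCherry = connected
  where
  open IsCherry isCherry

  Adj-∖ : ∀ {x y} → x ≢ y → ¬ Adj F x y → Adj (K n ∖ F) x y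
  Adj-∖ {x} {y} x≢y ¬xy with x ≟ y | adj F x y
  ... | yes x≡y | _     = ⊥-elim (x≢y x≡y)
  ... | no  _   | true  = ⊥-elim (¬xy _)
  ... | no  _   | false = _

  Detour : Fin n → Fin n → Set
  Detour x y = ∃ λ z → (x ≢ z × ¬ Adj F x z) × (y ≢ z × ¬ Adj F y z)

  detour-mid : ∀ {y} → Adj F u y → Detour u y
  detour-mid {y} uy =
    let z , z≢u , z≢v , z≢t = avoid-three 4≤n u v t
    in z , (≢-sym z≢u , avoids z≢v z≢t) , leaf z≢u z≢v z≢t (centre uy)
    where
    avoids : ∀ {z} → z ≢ v → z ≢ t → ¬ Adj F u z
    avoids z≢v z≢t uz with centre uz
    ... | inj₁ z≡v = z≢v z≡v
    ... | inj₂ z≡t = z≢t z≡t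
    leaf : ∀ {z} → z ≢ u → z ≢ v → z ≢ t → y ≡ v ⊎ y ≡ t → y ≢ z × ¬ Adj F y z
    leaf {z} z≢u z≢v z≢t y∈ = y≢z y∈ , λ yz → z≢u (other (≢-sym (Adj⇒≢ F uy)) yz (Adj-sym F uy))
      where
      y≢z : y ≡ v ⊎ y ≡ t → y ≢ z
      y≢z (inj₁ refl) = ≢-sym z≢v
      y≢z (inj₂ refl) = ≢-sym z≢t

  detour : ∀ {x y} → Adj F x y → Detour x y
  detour {x} {y} xy with x ≟ u | y ≟ u
  ... | yes refl | _        = detour-mid xy
  ... | no  _    | yes refl = let z , xz , yz = detour-mid (Adj-sym F xy) in z , yz , xz
  ... | no  x≢u  | no  y≢u  =
    -- Away from the centre the ends have only each other as neighbours, so just two vertices need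
    -- avoiding and `x` is repeated.
    let z , z≢x , z≢y , _ = avoid-three 4≤n x y x
    in z , (≢-sym z≢x , λ xz → z≢y (other x≢u xz xy))
         , (≢-sym z≢y , λ yz → z≢x (other y≢u yz (Adj-sym F xy)))

  connected : Connected (K n ∖ F)
  connected x y with x ≟ y | T? (adj F x y)
  ... | yes refl | _      = ε
  ... | no  x≢y  | no ¬xy = Adj-∖ x≢y ¬xy ◅ ε
  ... | no  _    | yes xy =
    let z , (x≢z , ¬xz) , (y≢z , ¬yz) = detour xy
    in Adj-∖ x≢z ¬xz ◅ Adj-sym (K n ∖ F) (Adj-∖ y≢z ¬yz) ◅ ε

-- Assembly of the inequality and the equality cases

module _ {n} (4≤n : 4 ≤ n) (c : ℚ) (c-inv : c ⊛ (ι n ⊖ 2ℚ) ≡ 1ℚ)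
         (γ : ℚ) (γ-inv : γ ⊛ ((ι n ⊖ 1ℚ) ⊛ (ι n ⊖ 3ℚ)) ≡ 1ℚ)
         {p} (2≤p : 2 ≤ p) (F : EdgeSet n) where

  Kf-≥-bound : size F ≡ p → Connected (K n ∖ F) → NotMatching F → Kf (K n ∖ F) ℚ.≥ kirchhoffBound n c γ p
  Kf-≥-bound refl connected (_ , _ , _ , v≢t , uv , ut) = bound-≤
    where open KirchhoffBound F connected c c-inv γ γ-inv uv ut v≢t

  Kf-≡-bound⇒≅ : size F ≡ p → Connected (K n ∖ F) → NotMatching F →
                 Kf (K n ∖ F) ≡ kirchhoffBound n c γ p → deletionGraph F ≅ P₃∪ (p ∸ 2) K₂
  Kf-≡-bound⇒≅ refl connected (_ , _ , _ , v≢t , uv , ut) Kf≡ =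
    let k , labelling = IsCherry⇒Labelling (tight⇒IsCherry Kf≡)
    in subst (λ k → deletionGraph F ≅ P₃∪ k K₂) (sym (cong (_∸ 2) (Labelling⇒size labelling)))
         (Labelling⇒≅ labelling)
    where open KirchhoffBound F connected c c-inv γ γ-inv uv ut v≢t

  -- For F₀ only the isomorphism is given, so size and connectivity are extracted from it. For F the
  -- same result is the converse half of the equality statement.
  ≅⇒Kf-≡-bound : deletionGraph F ≅ P₃∪ (p ∸ 2) K₂ → Kf (K n ∖ F) ≡ kirchhoffBound n c γ p
  ≅⇒Kf-≡-bound iso = trans (IsCherry⇒tight isCherry) (cong (kirchhoffBound n c γ) size≡p)
    where
    labelling = ≅⇒Labelling iso
    isCherry = Labelling⇒IsCherry labelling
    size≡p : size F ≡ p
    size≡p = trans (Labelling⇒size labelling) (ℕₚ.m+[n∸m]≡n 2≤p)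
    open IsCherry isCherry using (uv; ut; v≢t)
    open KirchhoffBound F (IsCherry⇒connected 4≤n isCherry) c c-inv γ γ-inv uv ut v≢t

theorem6p2 :
    ∀ (p n : ℕ) → 2 ≤ p → (n-large : 4 ⊔ (2 * p ∸ 1) ≤ n) →
    (F : EdgeSet n) → size F ≡ p → Connected (K n ∖ F) →
    (F₀ : EdgeSet n) → deletionGraph F₀ ≅ P 3 ⊍ copies (p ∸ 2) (K 2) →
    NotMatching F →
    let bound = lowerBound n p (m⊔n≤o⇒m≤o 4 (2 * p ∸ 1) n-large)
        extremal = deletionGraph F ≅ P 3 ⊍ copies (p ∸ 2) (K 2)
    in Kf (K n ∖ F) ℚ.≥ Kf (K n ∖ F₀)
       × Kf (K n ∖ F) ℚ.≥ bound
       × (Kf (K n ∖ F) ≡ Kf (K n ∖ F₀) ⇔ extremal)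
       × (Kf (K n ∖ F) ≡ bound ⇔ extremal)
theorem6p2 p n 2≤p n-large F size≡p connected F₀ F₀-extremal notMatching =
  let 4≤n = m⊔n≤o⇒m≤o 4 (2 * p ∸ 1) n-large
      c , γ , c-inv , γ-inv , lowerBound≡ = lowerBound-coefficients n 4≤n
  in conclude (lowerBound≡ p 2≤p)
       (Kf-≥-bound 4≤n c c-inv γ γ-inv 2≤p F size≡p connected notMatching)
       (≅⇒Kf-≡-bound 4≤n c c-inv γ γ-inv 2≤p F₀ F₀-extremal)
       (Kf-≡-bound⇒≅ 4≤n c c-inv γ γ-inv 2≤p F size≡p connected notMatching)
       (≅⇒Kf-≡-bound 4≤n c c-inv γ γ-inv 2≤p F)
  where
  -- Once `lb` and `Kf₀` are identified with `b`, the comparison with F₀ and the comparison with the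
  -- explicit bound are the same statement.
  conclude : ∀ {Kf Kf₀ lb b} {Extremal : Set} → lb ≡ b → Kf ℚ.≥ b → Kf₀ ≡ b →
             (Kf ≡ b → Extremal) → (Extremal → Kf ≡ b) →
             Kf ℚ.≥ Kf₀ × Kf ℚ.≥ lb × (Kf ≡ Kf₀ ⇔ Extremal) × (Kf ≡ lb ⇔ Extremal)
  conclude refl Kf≥ refl tight extremal = Kf≥ , Kf≥ , mk⇔ tight extremal , mk⇔ tight extremal
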